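{- For any partition $\rho$ (written $\rho=(\rho_1,\dots,\rho_{\ell(\rho)})$) and any positive integers $k$ and $m$, one has $$b^{k}_{\rho \cup (m)} = \delta_{m,1}\, b^k_{\rho} + 2 \sum_{1 \leq i \leq \ell(\rho)} \rho_i\, b^{k-1}_{\rho \setminus (\rho_{i}) \cup (\rho_{i}+m)} + \sum_{\substack{r+s=m \\ r,s \geq 1}} b^{k-1}_{\rho \cup (r,s)} + (m-1)\, b^{k-1}_{\rho \cup (m)},$$ where the sum over $r,s$ runs over ordered pairs $(r,s)$ of positive integers with $r+s=m$.
   Context: A partition $\lambda$ of $n\ge 0$ (written $\lambda\vdash n$) is a non-increasing finite sequence of positive integers (parts) with sum $n=|\lambda|$; $\ell(\lambda)$ is its number of parts. $\lambda\setminus(i)$ is the partition obtained by erasing one part equal to $i$, and $\lambda\cup(i)$, $\lambda\cup(i,j)$ are obtained by adding a part $i$, respectively parts $i$ and $j$ (and reordering). $\delta_{m,1}$ is the Kronecker delta. View $S_{2n}$ as the group of permutations of $\{1,\bar 1,\dots,n,\bar n\}$, with the convention $\overline{\bar i}=i$. The hyperoctahedral group $H_n\subset S_{2n}$ consists of the $\sigma$ with $\overline{\sigma(i)}=\sigma(\bar i)$ for all $i$. Put $p_n=\sum_{h\in H_n}h$. Coset-type: for $\sigma\in S_{2n}$, let $G_\sigma$ be the (multi)graph on vertex set $\{1,\bar1,\dots,n,\bar n\}$ with a solid edge between $i$ and $\bar i$ and a dashed edge between $\sigma(i)$ and $\sigma(\bar i)$ for each $i=1,\dots,n$. Every vertex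 has degree 2, and $G_\sigma$ is a disjoint union of cycles of even lengths $2\mu_1\ge 2\mu_2\ge\cdots$ (a solid and a dashed edge with the same endpoints form a cycle of length 2); the partition $\mu=(\mu_1,\mu_2,\dots)\vdash n$ is the coset-type of $\sigma$. Let $\mathcal{C}^{(2)}_\mu$ be the sum of all $\sigma\in S_{2n}$ of coset-type $\mu$. With the order $1<\bar1<2<\bar2<\cdots<n<\bar n$, the odd-indexed Jucys-Murphy elements are $$J^{(2)}_i=\sum_{j=1,\bar1,\dots,i-1,\overline{i-1}}(j\ i),\qquad 1\le i\le n .$$ They commute, and for every symmetric function $F$ the element $F(J^{(2)}_1,\dots,J^{(2)}_n)\,p_n$ is a linear combination of the $\mathcal{C}^{(2)}_\mu$, $\mu\vdash n$. Let $h_k$ denote the complete homogeneous symmetric function of degree $k$ ($h_0=1$). The coefficients $b^k_\mu$ are defined by $$h_k(J^{(2)}_1,\dots,J^{(2)}_n)\,p_n=\sum_{\mu\vdash n}b^k_\mu\,\mathcal{C}^{(2)}_\mu\qquad (n\ge 0),$$ with, for $n=0$, $b^k_\emptyset=\delta_{k,0}$. -}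

module Defs where

open import Data.Bool.Base using (if_then_else_)
open import Data.Fin.Base as Fin using (Fin; zero; suc; combine; remQuot; inject₁; fromℕ; opposite)
import Data.Fin.Properties as Fin
open import Data.Fin.Permutation as Perm using (Permutation′; _⟨$⟩ʳ_; _∘ₚ_; transpose; _≈_)
open import Data.Integer.Base as ℤ using (ℤ; 0ℤ; 1ℤ)
open import Data.List.Base as List using (List; []; _∷_; _++_; map; filter; foldr; concatMap; cartesianProductWith; allFin; length; mapMaybe)
import Data.List.Properties as List
open import Data.List.Membership.Propositional using (_∈_)
open import Data.List.Membership.Propositional.Properties using (∈-allFin)
open import Data.List.Relation.Binary.Permutation.Propositional using (↭-sym)
open import Data.List.Relation.Binary.Permutation.Propositional.Properties using (All-resp-↭)
open import Data.List.Relation.Unary.All using (All; []; _∷_; all?)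
open import Data.List.Relation.Unary.Any using (here; there)
open import Data.List.Relation.Unary.Linked using (Linked; linked?)
open import Data.List.Sort.Base using (module SortingAlgorithm)
import Data.List.Sort.InsertionSort as InsertionSort
open import Data.Maybe.Base using (Maybe; just; nothing)
open import Data.Nat.Base as ℕ using (ℕ; zero; suc; _≥_; NonZero)
import Data.Nat.Properties as ℕ
open import Data.Product.Base using (∃; _×_; _,_; proj₁; proj₂)
open import Data.Sum.Base using (_⊎_; inj₁; inj₂)
open import Function.Base using (_∘_)
open import Relation.Binary.Construct.Closure.ReflexiveTransitive using (Star; ε; _◅_; _◅◅_)
import Relation.Binary.Construct.Flip.EqAndOrd as Flip
open import Relation.Binary.PropositionalEquality using (_≡_; refl)
open import Relation.Nullary.Decidable using (Dec; yes; no; does; map′; _⊎-dec_; _×-dec_; _→-dec_)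

------------------------------------------------------------------------
-- Partitions

open InsertionSort (Flip.decTotalOrder ℕ.≤-decTotalOrder) using (insertionSort)
open SortingAlgorithm insertionSort public
  renaming (sort to sort≥; sort-↭ to sort≥-↭; sort-↗ to sort≥-↘)
  using ()

record Partition : Set where
  constructor mkPartition
  field
    parts         : List ℕ
    nonIncreasing : Linked _≥_ parts
    positive      : All NonZero parts

open Partition public

ℓ : Partition → ℕ
ℓ = length ∘ parts

part : (ρ : Partition) → Fin (ℓ ρ) → ℕ
part ρ = List.lookup (parts ρ)

fromParts : (xs : List ℕ) → All NonZero xs → Partition
fromParts xs ps = mkPartition (sort≥ xs) (sort≥-↘ xs) (All-resp-↭ (↭-sym (sort≥-↭ xs)) ps)

erase : ℕ → List ℕ → List ℕ
erase i []       = []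
erase i (x ∷ xs) with i ℕ.≟ x
... | yes _ = xs
... | no  _ = x ∷ erase i xs

erase⁺ : ∀ {P : ℕ → Set} i {xs} → All P xs → All P (erase i xs)
erase⁺ i []                    = []
erase⁺ i (_∷_ {x} px pxs) with i ℕ.≟ x
... | yes _ = pxs
... | no  _ = px ∷ erase⁺ i pxs

infixl 6 _∪_ _∖_

_∪_ : Partition → (i : ℕ) {{_ : NonZero i}} → Partition
_∪_ ρ i {{i≢0}} = fromParts (i ∷ parts ρ) (i≢0 ∷ positive ρ)

-- If i is not a part of ρ then ρ ∖ i is ρ.
_∖_ : Partition → ℕ → Partition
ρ ∖ i = fromParts (erase i (parts ρ)) (erase⁺ i (positive ρ))

-- All lists of positive integers with sum n, each exactly once.
compositions : ℕ → List (List ℕ)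
compositions zero          = [] ∷ []
compositions (suc zero)    = (1 ∷ []) ∷ []
compositions (suc (suc n)) =
  map (1 ∷_) (compositions (suc n)) ++ map incrementHead (compositions (suc n))
  where
  incrementHead : List ℕ → List ℕ
  incrementHead []       = []
  incrementHead (x ∷ xs) = suc x ∷ xs

toPartition : List ℕ → Maybe Partition
toPartition xs with linked? ℕ._≥?_ xs | all? ℕ.nonZero? xs
... | yes d | yes p = just (mkPartition xs d p)
... | yes _ | no  _ = nothing
... | no  _ | _     = nothing

partitions : ℕ → List Partition
partitions n = mapMaybe toPartition (compositions n)

------------------------------------------------------------------------
-- The group ring ℤ[S_N]

-- Elements are formal sums, compared by _≋_ below: the coefficient of σ
-- collects all terms whose permutation is pointwise equal to σ.
ℤ[S_] : ℕ → Set
ℤ[S N ] = List (ℤ × Permutation′ N)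

private variable
  N n : ℕ

infix 4 _≈?_ _≋_

_≈?_ : (σ τ : Permutation′ N) → Dec (σ ≈ τ)
σ ≈? τ = Fin.all? (λ i → (σ ⟨$⟩ʳ i) Fin.≟ (τ ⟨$⟩ʳ i))

coeff : ℤ[S N ] → Permutation′ N → ℤ
coeff []             σ = 0ℤ
coeff ((a , τ) ∷ xs) σ = (if does (τ ≈? σ) then a else 0ℤ) ℤ.+ coeff xs σ

_≋_ : ℤ[S N ] → ℤ[S N ] → Set
x ≋ y = ∀ σ → coeff x σ ≡ coeff y σ

infixl 7 _·_ _⊛_
infixr 8 _•_

-- Products of permutations are composed from right to left, whereas
-- _∘ₚ_ applies its left argument first.
_·_ : Permutation′ N → Permutation′ N → Permutation′ N
σ · τ = τ ∘ₚ σ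

𝟙 : ℤ[S N ]
𝟙 = (1ℤ , Perm.id) ∷ []

_⊛_ : ℤ[S N ] → ℤ[S N ] → ℤ[S N ]
_⊛_ = cartesianProductWith (λ s t → proj₁ s ℤ.* proj₁ t , proj₂ s · proj₂ t)

_•_ : ℤ → ℤ[S N ] → ℤ[S N ]
c • x = map (λ s → c ℤ.* proj₁ s , proj₂ s) x

sumOf : List (Permutation′ N) → ℤ[S N ]
sumOf = map (1ℤ ,_)

-- Every element of S_N, exactly once up to _≈_.
permutations : ∀ N → List (Permutation′ N)
permutations zero    = Perm.id ∷ []
permutations (suc N) =
  cartesianProductWith (Perm.insert zero) (allFin (suc N)) (permutations N)

-- The indices i₁ ≥ i₂ ≥ … ≥ i_k of the monomials of degree k in n variables.
monomials : (k n : ℕ) → List (List (Fin n))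
monomials zero    n       = [] ∷ []
monomials (suc k) zero    = []
monomials (suc k) (suc n) =
  map (fromℕ n ∷_) (monomials k (suc n)) ++ map (map inject₁) (monomials (suc k) n)

-- For pairwise commuting x the order of the factors is immaterial; here
-- they are multiplied in weakly decreasing order of index.
completeHomogeneous : ℕ → (Fin n → ℤ[S N ]) → ℤ[S N ]
completeHomogeneous k x =
  concatMap (λ is → foldr _⊛_ 𝟙 (map x is)) (monomials k _)

------------------------------------------------------------------------
-- The hyperoctahedral group

-- The letters 1 < 1̄ < 2 < 2̄ < … < n < n̄ are, in this order, the elements
-- of Fin (n * 2): i is combine i zero and ī is combine i (suc zero), where
-- i : Fin n is counted from zero.
Letter : ℕ → Set
Letter n = Fin (n ℕ.* 2)

plain : Fin n → Letter n
plain i = combine i zero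

bar : Letter n → Letter n
bar {n} x = combine (proj₁ (remQuot {n} 2 x)) (opposite (proj₂ (remQuot {n} 2 x)))

Hyperoctahedral : ∀ n → Permutation′ (n ℕ.* 2) → Set
Hyperoctahedral n σ = ∀ x → bar {n} (σ ⟨$⟩ʳ x) ≡ σ ⟨$⟩ʳ bar {n} x

hyperoctahedral? : ∀ n σ → Dec (Hyperoctahedral n σ)
hyperoctahedral? n σ = Fin.all? (λ x → bar {n} (σ ⟨$⟩ʳ x) Fin.≟ (σ ⟨$⟩ʳ bar {n} x))

p : ∀ n → ℤ[S n ℕ.* 2 ]
p n = sumOf (filter (hyperoctahedral? n) (permutations (n ℕ.* 2)))

JM : ∀ n → Fin n → ℤ[S n ℕ.* 2 ]
JM n i = sumOf (map (λ j → transpose j (plain i)) (filter (Fin._<? plain i) (allFin (n ℕ.* 2))))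

------------------------------------------------------------------------
-- Decidability of reachability in a finite graph

module Reachability {N : ℕ} {R : Fin N → Fin N → Set} (R? : ∀ x y → Dec (R x y)) where

  -- Reachability through intermediate vertices in a given list.
  Via : List (Fin N) → Fin N → Fin N → Set
  Via []       x y = x ≡ y ⊎ R x y
  Via (v ∷ vs) x y = Via vs x y ⊎ (Via vs x v × Via vs v y)

  via? : ∀ vs x y → Dec (Via vs x y)
  via? []       x y = (x Fin.≟ y) ⊎-dec R? x y
  via? (v ∷ vs) x y = via? vs x y ⊎-dec (via? vs x v ×-dec via? vs v y)

  via⇒star : ∀ vs {x y} → Via vs x y → Star R x y
  via⇒star []       (inj₁ refl)    = ε
  via⇒star []       (inj₂ r)       = r ◅ ε
  via⇒star (v ∷ vs) (inj₁ q)       = via⇒star vs q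
  via⇒star (v ∷ vs) (inj₂ (q , r)) = via⇒star vs q ◅◅ via⇒star vs r

  base⇒via : ∀ vs {x y} → x ≡ y ⊎ R x y → Via vs x y
  base⇒via []       q = q
  base⇒via (v ∷ vs) q = inj₁ (base⇒via vs q)

  via-trans : ∀ {vs x v y} → v ∈ vs → Via vs x v → Via vs v y → Via vs x y
  via-trans (here refl) (inj₁ q)       (inj₁ r)       = inj₂ (q , r)
  via-trans (here refl) (inj₁ q)       (inj₂ (_ , r)) = inj₂ (q , r)
  via-trans (here refl) (inj₂ (q , _)) (inj₁ r)       = inj₂ (q , r)
  via-trans (here refl) (inj₂ (q , _)) (inj₂ (_ , r)) = inj₂ (q , r)
  via-trans (there v∈)  (inj₁ q)       (inj₁ r)       = inj₁ (via-trans v∈ q r)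
  via-trans (there v∈)  (inj₁ q)       (inj₂ (r , s)) = inj₂ (via-trans v∈ q r , s)
  via-trans (there v∈)  (inj₂ (q , r)) (inj₁ s)       = inj₂ (q , via-trans v∈ r s)
  via-trans (there v∈)  (inj₂ (q , _)) (inj₂ (_ , s)) = inj₂ (q , s)

  star⇒via : ∀ {x y} → Star R x y → Via (allFin N) x y
  star⇒via ε       = base⇒via (allFin N) (inj₁ refl)
  star⇒via (_◅_ {j = v} r rs) =
    via-trans (∈-allFin v) (base⇒via (allFin N) (inj₂ r)) (star⇒via rs)

  star? : ∀ x y → Dec (Star R x y)
  star? x y = map′ (via⇒star (allFin N)) star⇒via (via? (allFin N) x y)

------------------------------------------------------------------------
-- Coset-type

module _ (n : ℕ) (σ : Permutation′ (n ℕ.* 2)) where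

  Solid Dashed Adjacent Connected : Letter n → Letter n → Set

  Solid x y = y ≡ bar {n} x

  -- Ranging over all letters z, barred or not, makes the relation symmetric.
  Dashed x y = ∃ λ z → x ≡ σ ⟨$⟩ʳ z × y ≡ σ ⟨$⟩ʳ bar {n} z

  Adjacent x y = Solid x y ⊎ Dashed x y

  Connected = Star Adjacent

  adjacent? : ∀ x y → Dec (Adjacent x y)
  adjacent? x y = (y Fin.≟ bar {n} x) ⊎-dec
    Fin.any? (λ z → (x Fin.≟ (σ ⟨$⟩ʳ z)) ×-dec (y Fin.≟ (σ ⟨$⟩ʳ bar {n} z)))

  connected? : ∀ x y → Dec (Connected x y)
  connected? = Reachability.star? adjacent?

  IsLeast : Letter n → Set
  IsLeast x = ∀ y → Connected x y → x Fin.≤ y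

  isLeast? : ∀ x → Dec (IsLeast x)
  isLeast? x = Fin.all? (λ y → connected? x y →-dec (x Fin.≤? y))

  -- The components of the graph are cycles, so that the length of a cycle
  -- (2 when a solid and a dashed edge coincide) is its number of vertices.
  -- Each cycle is represented by its least vertex.
  cycleLengths : List ℕ
  cycleLengths =
    map (λ x → length (filter (connected? x) (allFin (n ℕ.* 2))))
        (filter isLeast? (allFin (n ℕ.* 2)))

  HasCosetType : Partition → Set
  HasCosetType μ = sort≥ cycleLengths ≡ map (2 ℕ.*_) (parts μ)

  hasCosetType? : ∀ μ → Dec (HasCosetType μ)
  hasCosetType? μ = List.≡-dec ℕ._≟_ (sort≥ cycleLengths) (map (2 ℕ.*_) (parts μ))

C : ∀ n → Partition → ℤ[S n ℕ.* 2 ]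
C n μ = sumOf (filter (λ σ → hasCosetType? n σ μ) (permutations (n ℕ.* 2)))

------------------------------------------------------------------------
-- The coefficients b^k_μ

-- The defining equation of the coefficients.  It determines b, since the
-- C n μ for μ ⊢ n have nonempty and disjoint supports.  At n = 0 it says
-- that b k of the empty partition is 1 if k = 0 and 0 otherwise.
IsCoefficients : (ℕ → Partition → ℤ) → Set
IsCoefficients b = ∀ k n →
  completeHomogeneous k (JM n) ⊛ p n ≋ concatMap (λ μ → b k μ • C n μ) (partitions n)

δ : ℕ → ℕ → ℤ
δ i j = if does (i ℕ.≟ j) then 1ℤ else 0ℤ

{-# OPTIONS --safe #-}
-- Evaluate h_{k+1}(J₁, …, J_{n+1}) p_{n+1} at one permutation σ of coset-type
-- ρ ∪ (m) whose cycle of length 2m contains the last letter x = n+1, using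
--   h_{k+1}(J₁, …, J_{n+1}) = J_{n+1} h_k(J₁, …, J_{n+1}) + h_{k+1}(J₁, …, J_n).
-- The first term contributes the coefficients at (j x) σ for the letters
-- j ≠ x, x̄, and (j x) exchanges two ends of dashed edges of the graph of σ.
-- If j lies in another cycle, the two cycles are joined.  If j lies in the cycle
-- of x, half of the j cut that cycle in two, at each of its m − 1 inner places,
-- and for the other half a part of the cycle is reversed and the type is kept.
-- The second term involves only permutations fixing x and x̄.  It vanishes
-- unless x and x̄ are joined by a dashed edge, that is m = 1, in which case
-- σ may be taken in S_{2n} and the term is the coefficient for n.
module Submission where

open import Defs
open import Data.Bool.Base using (true; false; if_then_else_)
open import Data.Empty using (⊥)
open import Data.Fin.Base as Fin using (Fin; zero; suc; toℕ; opposite; fromℕ; inject₁; combine; punchIn)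
import Data.Fin.Properties as Fin
open import Data.Fin.Relation.Unary.Top using (view; ‵fromℕ; ‵inject₁)
open import Data.Fin.Permutation as Perm using (Permutation′; _⟨$⟩ʳ_; _⟨$⟩ˡ_; transpose; _≈_; flip; insert; remove)
open import Data.Integer.Base as ℤ using (ℤ; 0ℤ; 1ℤ; +_; _+_; _*_)
import Data.Integer.Properties as ℤ
open import Algebra.Properties.CommutativeSemigroup ℤ.+-commutativeSemigroup using (interchange)
open import Data.Integer.Properties using (+-0-commutativeMonoid)
open import Data.List.Base as List using (List; []; _∷_; _++_; map; filter; foldr; concat; concatMap; cartesianProductWith; allFin; length; mapMaybe; lookup; reverse; [_])
import Data.List.Properties as List
import Data.List.Extrema as Extrema
open import Data.List.Membership.Propositional using (_∈_)
open import Data.List.Membership.Propositional.Properties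
open import Data.List.Membership.Propositional.Properties.WithK using (unique∧set⇒bag)
open import Data.List.Relation.Binary.BagAndSetEquality using (∼bag⇒↭)
open import Data.List.Relation.Binary.Permutation.Propositional as Perm↭ using (_↭_; prep; swap; ↭-refl; ↭-sym; ↭-trans; ↭-reflexive; ↭⇒↭ₛ; module PermutationReasoning)
open import Data.List.Relation.Binary.Permutation.Propositional.Properties as ↭ using (All-resp-↭; ∈-resp-↭; drop-∷; filter-↭; ↭-reverse)
import Data.List.Relation.Binary.Permutation.Setoid.Properties as ↭ₛ
open import Data.List.Relation.Binary.Pointwise using (Pointwise-≡⇒≡)
open import Data.List.Relation.Unary.All as All using (All; []; _∷_; all?)
import Data.List.Relation.Unary.All.Properties as All
open import Data.List.Relation.Unary.AllPairs using ([]; _∷_)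
open import Data.List.Relation.Unary.Any using (here; there)
open import Data.List.Relation.Unary.Linked as Linked using (Linked; linked?)
import Data.List.Relation.Unary.Linked.Properties as Linked
open import Data.List.Relation.Unary.Sorted.TotalOrder.Properties using (↗↭↗⇒≋)
open import Data.List.Relation.Unary.Unique.Propositional using (Unique)
import Data.List.Relation.Unary.Unique.Propositional.Properties as Unique
open import Data.Maybe.Base using (Maybe; just; nothing; maybe′)
open import Data.Nat.Base as ℕ using (ℕ; zero; suc; NonZero; _≥_)
import Data.Nat.Properties as ℕ
open import Data.Nat.ListAction using () renaming (sum to sumℕ)
open import Data.Nat.ListAction.Properties using (sum-↭)
open import Data.Product.Base using (∃; ∃₂; _×_; _,_; proj₁; proj₂)
open import Data.Sum.Base using (_⊎_; inj₁; inj₂)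
open import Function.Base using (_∘_)
open import Function.Bundles using (_⇔_; mk⇔; Equivalence)
open import Relation.Binary.Construct.Closure.ReflexiveTransitive using (Star; ε; _◅_; _◅◅_)
import Relation.Binary.Construct.Closure.ReflexiveTransitive as Star
import Relation.Binary.Construct.Flip.EqAndOrd as Flip
open import Relation.Binary.PropositionalEquality using (_≡_; _≢_; refl; sym; trans; cong; cong₂; subst; subst₂; setoid; module ≡-Reasoning)
open import Relation.Nullary.Decidable using (Dec; yes; no; does; map′; dec-true; dec-false; does-⇔)
open import Relation.Nullary.Negation using (¬_; contradiction)
open import Algebra.Properties.CommutativeMonoid.Sum +-0-commutativeMonoid using (sum-syntax; sum-cong-≗)

-- Coset-type is defined through reachability and least vertices, which is hard to follow under
-- multiplication by (j x). Every permutation met in the proof therefore carries a `Decomposition`: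
-- explicit oriented cycles, given by one end of each solid edge. Multiplication by (j x) becomes
-- surgery on these lists, and the type is read off from their lengths; a cycle with r solid edges
-- has 2r letters, whence the factor 2ρ_i. Since `IsCoefficients` holds for all k and n, one σ with
-- a known decomposition suffices for each ρ and m, and such a σ is constructed. In
-- `completeHomogeneous` the largest index stands leftmost, so J_{n+1} splits off on the left, where
-- multiplication acts on coefficient functions as a convolution. The second term can vanish because
-- every solid edge of a hyperoctahedral permutation is also dashed, while the transpositions in
-- J_1, ..., J_n fix x and x̄ and so neither create nor destroy a dashed edge between them.

private variable
  A B : Set
  N n : ℕ

-- Sums of integers over lists

Σ[_] : List A → (A → ℤ) → ℤ
Σ[ []     ] f = 0ℤ
Σ[ x ∷ xs ] f = f x + Σ[ xs ] f

Σ-cong : (xs : List A) {f g : A → ℤ} → (∀ {x} → x ∈ xs → f x ≡ g x) → Σ[ xs ] f ≡ Σ[ xs ] g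
Σ-cong []       f≗g = refl
Σ-cong (x ∷ xs) f≗g = cong₂ _+_ (f≗g (here refl)) (Σ-cong xs (f≗g ∘ there))

Σ-++ : (xs ys : List A) (f : A → ℤ) → Σ[ xs ++ ys ] f ≡ Σ[ xs ] f + Σ[ ys ] f
Σ-++ []       ys f = sym (ℤ.+-identityˡ _)
Σ-++ (x ∷ xs) ys f = trans (cong (_+_ (f x)) (Σ-++ xs ys f)) (sym (ℤ.+-assoc (f x) _ _))

Σ-map : (h : B → A) (xs : List B) (f : A → ℤ) → Σ[ map h xs ] f ≡ Σ[ xs ] (f ∘ h)
Σ-map h []       f = refl
Σ-map h (x ∷ xs) f = cong (_+_ (f (h x))) (Σ-map h xs f)

Σ-zero : (xs : List A) {f : A → ℤ} → (∀ {x} → x ∈ xs → f x ≡ 0ℤ) → Σ[ xs ] f ≡ 0ℤ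
Σ-zero []       f≗0 = refl
Σ-zero (x ∷ xs) f≗0 = cong₂ _+_ (f≗0 (here refl)) (Σ-zero xs (f≗0 ∘ there))

Σ-const : (xs : List A) (c : ℤ) → Σ[ xs ] (λ _ → c) ≡ + length xs * c
Σ-const []       c = refl
Σ-const (x ∷ xs) c = trans (cong (_+_ c) (Σ-const xs c)) (sym (ℤ.suc-* (+ length xs) c))

Σ-* : (c : ℤ) (xs : List A) (f : A → ℤ) → Σ[ xs ] (λ x → c * f x) ≡ c * Σ[ xs ] f
Σ-* c []       f = sym (ℤ.*-zeroʳ c)
Σ-* c (x ∷ xs) f = trans (cong (_+_ (c * f x)) (Σ-* c xs f)) (sym (ℤ.*-distribˡ-+ c _ _))

Σ-+ : (xs : List A) (f g : A → ℤ) → Σ[ xs ] (λ x → f x + g x) ≡ Σ[ xs ] f + Σ[ xs ] g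
Σ-+ []       f g = refl
Σ-+ (x ∷ xs) f g = trans (cong (_+_ (f x + g x)) (Σ-+ xs f g)) (interchange (f x) (g x) _ _)

Σ-swap : (xs : List A) (ys : List B) (f : A → B → ℤ) →
         Σ[ xs ] (λ x → Σ[ ys ] (f x)) ≡ Σ[ ys ] (λ y → Σ[ xs ] (λ x → f x y))
Σ-swap []       ys f = sym (Σ-zero ys (λ _ → refl))
Σ-swap (x ∷ xs) ys f = trans (cong (_+_ (Σ[ ys ] (f x))) (Σ-swap xs ys f)) (sym (Σ-+ ys (f x) _))

Σ-↭ : {xs ys : List A} (f : A → ℤ) → xs ↭ ys → Σ[ xs ] f ≡ Σ[ ys ] f
Σ-↭ f Perm↭.refl    = refl
Σ-↭ f (prep x p)    = cong (_+_ (f x)) (Σ-↭ f p)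
Σ-↭ f (swap x y p)  = begin
  f x + (f y + _)  ≡⟨ sym (ℤ.+-assoc (f x) (f y) _) ⟩
  (f x + f y) + _  ≡⟨ cong₂ _+_ (ℤ.+-comm (f x) (f y)) (Σ-↭ f p) ⟩
  (f y + f x) + _  ≡⟨ ℤ.+-assoc (f y) (f x) _ ⟩
  f y + (f x + _)  ∎
  where open ≡-Reasoning
Σ-↭ f (Perm↭.trans p q) = trans (Σ-↭ f p) (Σ-↭ f q)

Σ-filter : {P : A → Set} (P? : ∀ x → Dec (P x)) (xs : List A) {f : A → ℤ} →
           (∀ {x} → ¬ P x → f x ≡ 0ℤ) → Σ[ filter P? xs ] f ≡ Σ[ xs ] f
Σ-filter P? []       f≗0 = refl
Σ-filter P? (x ∷ xs) {f} f≗0 with P? x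
... | yes _ = cong (_+_ (f x)) (Σ-filter P? xs f≗0)
... | no ¬p = trans (Σ-filter P? xs f≗0) (sym (trans (cong (λ z → z + Σ[ xs ] f) (f≗0 ¬p)) (ℤ.+-identityˡ _)))

Σ-indicator : {xs : List A} {y : A} → Unique xs → y ∈ xs → (f : A → ℤ) →
              (∀ {x} → x ≢ y → f x ≡ 0ℤ) → Σ[ xs ] f ≡ f y
Σ-indicator {xs = x ∷ xs} (x∉ ∷ _)  (here refl)  f f≗0 =
  trans (cong (_+_ (f x)) (Σ-zero xs λ x′∈ → f≗0 (All.lookup x∉ x′∈ ∘ sym))) (ℤ.+-identityʳ _)
Σ-indicator {xs = x ∷ xs} (x∉ ∷ uq) (there y∈) f f≗0 =
  trans (cong₂ _+_ (f≗0 (All.lookup x∉ y∈)) (Σ-indicator uq y∈ f f≗0)) (ℤ.+-identityˡ _)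

∑-lookup : (xs : List A) (f : A → ℤ) → ∑[ i < length xs ] f (lookup xs i) ≡ Σ[ xs ] f
∑-lookup []       f = refl
∑-lookup (x ∷ xs) f = cong (_+_ (f x)) (∑-lookup xs f)

-- The group ring

𝟏 : {P : Set} → Dec P → ℤ
𝟏 P? = if does P? then 1ℤ else 0ℤ

coeff-++ : (x y : ℤ[S N ]) (σ : Permutation′ N) → coeff (x ++ y) σ ≡ coeff x σ + coeff y σ
coeff-++ []            y σ = sym (ℤ.+-identityˡ _)
coeff-++ ((a , τ) ∷ x) y σ =
  trans (cong (_+_ a′) (coeff-++ x y σ)) (sym (ℤ.+-assoc a′ (coeff x σ) (coeff y σ)))
  where
  a′ = if does (τ ≈? σ) then a else 0ℤ

coeff-concatMap : (f : A → ℤ[S N ]) (xs : List A) (σ : Permutation′ N) →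
                  coeff (concatMap f xs) σ ≡ Σ[ xs ] (λ x → coeff (f x) σ)
coeff-concatMap f []       σ = refl
coeff-concatMap f (x ∷ xs) σ = trans (coeff-++ (f x) _ σ) (cong (_+_ (coeff (f x) σ)) (coeff-concatMap f xs σ))

coeff-• : (c : ℤ) (x : ℤ[S N ]) (σ : Permutation′ N) → coeff (c • x) σ ≡ c * coeff x σ
coeff-• c []            σ = sym (ℤ.*-zeroʳ c)
coeff-• c ((a , τ) ∷ x) σ with does (τ ≈? σ)
... | true  = trans (cong (_+_ (c * a)) (coeff-• c x σ)) (sym (ℤ.*-distribˡ-+ c a _))
... | false = trans (ℤ.+-identityˡ _)
                (trans (coeff-• c x σ) (cong (c *_) (sym (ℤ.+-identityˡ _))))

coeff-sumOf : (L : List (Permutation′ N)) (σ : Permutation′ N) →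
              coeff (sumOf L) σ ≡ Σ[ L ] (λ τ → 𝟏 (τ ≈? σ))
coeff-sumOf []      σ = refl
coeff-sumOf (τ ∷ L) σ = cong (_+_ (𝟏 (τ ≈? σ))) (coeff-sumOf L σ)

≈-sym : {σ τ : Permutation′ N} → σ ≈ τ → τ ≈ σ
≈-sym σ≈τ i = sym (σ≈τ i)

≈-trans : {σ τ υ : Permutation′ N} → σ ≈ τ → τ ≈ υ → σ ≈ υ
≈-trans σ≈τ τ≈υ i = trans (σ≈τ i) (τ≈υ i)

-- A permutation is a record of two maps with proofs, so pointwise equal permutations need not be
-- propositionally equal, and a function of them has to be shown to respect `≈`.
Invariant : (Permutation′ N → ℤ) → Set
Invariant g = ∀ σ τ → σ ≈ τ → g σ ≡ g τ

coeff-invariant : (x : ℤ[S N ]) → Invariant (coeff x)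
coeff-invariant []            σ τ σ≈τ = refl
coeff-invariant ((a , υ) ∷ x) σ τ σ≈τ = cong₂ (λ d s → (if d then a else 0ℤ) + s)
  (does-⇔ (mk⇔ (λ e → ≈-trans {σ = υ} {σ} {τ} e σ≈τ) (λ e → ≈-trans {σ = υ} {τ} {σ} e (≈-sym {σ = σ} {τ} σ≈τ)))
    (υ ≈? σ) (υ ≈? τ))
  (coeff-invariant x σ τ σ≈τ)

infixr 7 _▹_

-- Convolution: multiplying by x on the left acts in this way on the
-- function of coefficients.
_▹_ : ℤ[S N ] → (Permutation′ N → ℤ) → Permutation′ N → ℤ
(x ▹ g) σ = Σ[ x ] (λ s → proj₁ s * g (flip (proj₂ s) · σ))

▹-invariant : (x : ℤ[S N ]) {g : Permutation′ N → ℤ} → Invariant g → Invariant (x ▹ g)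
▹-invariant x {g} inv σ τ σ≈τ = Σ-cong x λ {s} _ →
  cong (proj₁ s *_) (inv _ _ λ i → cong (proj₂ s ⟨$⟩ˡ_) (σ≈τ i))

▹-cong : (x : ℤ[S N ]) {g h : Permutation′ N → ℤ} → (∀ σ → g σ ≡ h σ) → ∀ σ → (x ▹ g) σ ≡ (x ▹ h) σ
▹-cong x g≗h σ = Σ-cong x λ {s} _ → cong (proj₁ s *_) (g≗h _)

▹-++ : (x y : ℤ[S N ]) (g : Permutation′ N → ℤ) (σ : Permutation′ N) →
       ((x ++ y) ▹ g) σ ≡ (x ▹ g) σ + (y ▹ g) σ
▹-++ x y g σ = Σ-++ x y _

▹-concatMap : (f : A → ℤ[S N ]) (xs : List A) (g : Permutation′ N → ℤ) (σ : Permutation′ N) →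
              (concatMap f xs ▹ g) σ ≡ Σ[ xs ] (λ a → (f a ▹ g) σ)
▹-concatMap f []       g σ = refl
▹-concatMap f (a ∷ xs) g σ = trans (▹-++ (f a) _ g σ) (cong (_+_ ((f a ▹ g) σ)) (▹-concatMap f xs g σ))

▹-⊛ : (x y : ℤ[S N ]) {g : Permutation′ N → ℤ} → Invariant g →
      ∀ σ → ((x ⊛ y) ▹ g) σ ≡ (x ▹ y ▹ g) σ
▹-⊛ []            y     inv σ = refl
▹-⊛ ((a , τ) ∷ x) y {g} inv σ = trans (▹-++ (map _ y) (x ⊛ y) g σ) (cong₂ _+_ (begin
  (map (λ t → a * proj₁ t , τ · proj₂ t) y ▹ g) σ
    ≡⟨ Σ-map (λ t → a * proj₁ t , τ · proj₂ t) y _ ⟩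
  Σ[ y ] (λ t → a * proj₁ t * g (flip (τ · proj₂ t) · σ))
    ≡⟨ Σ-cong y (λ {t} _ → trans (ℤ.*-assoc a (proj₁ t) _)
         (cong (λ z → a * (proj₁ t * z)) (inv (flip (τ · proj₂ t) · σ) (flip (proj₂ t) · (flip τ · σ)) λ _ → refl))) ⟩
  Σ[ y ] (λ t → a * (proj₁ t * g (flip (proj₂ t) · (flip τ · σ))))
    ≡⟨ Σ-* a y (λ t → proj₁ t * g (flip (proj₂ t) · (flip τ · σ))) ⟩
  a * (y ▹ g) (flip τ · σ)
    ∎) (▹-⊛ x y inv σ))
  where open ≡-Reasoning

-- A product τυ equals σ exactly when υ equals τ⁻¹σ.
coeff-⊛ : (x y : ℤ[S N ]) (σ : Permutation′ N) → coeff (x ⊛ y) σ ≡ (x ▹ coeff y) σ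
coeff-⊛ []            y σ = refl
coeff-⊛ ((a , τ) ∷ x) y σ = trans (coeff-++ (map _ y) (x ⊛ y) σ) (cong₂ _+_ (translate y) (coeff-⊛ x y σ))
  where
  translate : ∀ z → coeff (map (λ t → a * proj₁ t , τ · proj₂ t) z) σ ≡ a * coeff z (flip τ · σ)
  translate []            = sym (ℤ.*-zeroʳ a)
  translate ((b , υ) ∷ z)
    rewrite does-⇔ (mk⇔ (λ e i → trans (sym (Perm.inverseˡ τ)) (cong (τ ⟨$⟩ˡ_) (e i)))
                        (λ e i → trans (cong (τ ⟨$⟩ʳ_) (e i)) (Perm.inverseʳ τ)))
                   ((τ · υ) ≈? σ) (υ ≈? (flip τ · σ))
    with does (υ ≈? (flip τ · σ))
  ... | true  = trans (cong (_+_ (a * b)) (translate z)) (sym (ℤ.*-distribˡ-+ a b _))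
  ... | false = trans (ℤ.+-identityˡ _)
                  (trans (translate z) (cong (a *_) (sym (ℤ.+-identityˡ _))))

-- Enumeration of the symmetric group and class sums

Σ-cartesianProductWith : {D : Set} (h : A → B → D) (xs : List A) (ys : List B) (f : D → ℤ) →
  Σ[ cartesianProductWith h xs ys ] f ≡ Σ[ xs ] (λ x → Σ[ ys ] (λ y → f (h x y)))
Σ-cartesianProductWith h []       ys f = refl
Σ-cartesianProductWith h (x ∷ xs) ys f =
  trans (Σ-++ (map (h x) ys) _ f) (cong₂ _+_ (Σ-map (h x) ys f) (Σ-cartesianProductWith h xs ys f))

-- A permutation amounts to the image of `zero` together with what is left after removing `zero`;
-- this is the recursion of `permutations`.
insert-≈⇔ : (j : Fin (suc N)) (π : Permutation′ N) (σ : Permutation′ (suc N)) →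
            σ ⟨$⟩ʳ zero ≡ j → (insert zero j π ≈ σ) ⇔ (π ≈ remove zero σ)
insert-≈⇔ _ π σ refl = mk⇔
  (λ e k → Fin.punchIn-injective (σ ⟨$⟩ʳ zero) _ _ (trans (sym (Perm.insert-punchIn zero _ π k))
     (trans (e (suc k)) (Perm.punchIn-permute σ zero k))))
  (λ { e zero    → refl
     ; e (suc k) → trans (Perm.insert-punchIn zero _ π k)
         (trans (cong (punchIn _) (e k)) (sym (Perm.punchIn-permute σ zero k))) })

-- Among the possible images of `zero` only that of σ contributes, and for it the induction
-- hypothesis applies to σ with `zero` removed. So σ is listed exactly once up to `≈`.
Σ-permutations : (σ : Permutation′ N) → Σ[ permutations N ] (λ τ → 𝟏 (τ ≈? σ)) ≡ 1ℤ
Σ-permutations {zero}  σ rewrite dec-true (Perm.id ≈? σ) (λ ()) = refl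
Σ-permutations {suc N} σ = begin
  Σ[ permutations (suc N) ] (λ τ → 𝟏 (τ ≈? σ))
    ≡⟨ Σ-cartesianProductWith (insert zero) (allFin (suc N)) (permutations N) _ ⟩
  Σ[ allFin (suc N) ] (λ j → Σ[ permutations N ] (λ π → 𝟏 (insert zero j π ≈? σ)))
    ≡⟨ Σ-indicator (Unique.allFin⁺ (suc N)) (∈-allFin (σ ⟨$⟩ʳ zero)) _
         (λ {j} j≢ → Σ-zero (permutations N) λ {π} _ →
            cong (if_then 1ℤ else 0ℤ) (dec-false (insert zero j π ≈? σ) λ e → j≢ (e zero))) ⟩
  Σ[ permutations N ] (λ π → 𝟏 (insert zero (σ ⟨$⟩ʳ zero) π ≈? σ))
    ≡⟨ Σ-cong (permutations N) (λ {π} _ → cong (if_then 1ℤ else 0ℤ)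
         (does-⇔ (insert-≈⇔ (σ ⟨$⟩ʳ zero) π σ refl) (insert zero _ π ≈? σ) (π ≈? remove zero σ))) ⟩
  Σ[ permutations N ] (λ π → 𝟏 (π ≈? remove zero σ))
    ≡⟨ Σ-permutations (remove zero σ) ⟩
  1ℤ ∎
  where open ≡-Reasoning

-- The coefficient function of a class sum is the indicator of the class. `Q` is kept separate from
-- `P` so that membership can be replaced by an equivalent condition, such as an equation between
-- partitions.
coeff-filter : {P : Permutation′ N → Set} {Q : Set} (P? : ∀ τ → Dec (P τ)) (Q? : Dec Q) (σ : Permutation′ N) →
               (∀ {τ} → τ ≈ σ → P τ ⇔ Q) →
               coeff (sumOf (filter P? (permutations N))) σ ≡ 𝟏 Q?
coeff-filter {N} P? (yes q) σ P⇔Q = begin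
  coeff (sumOf (filter P? (permutations N))) σ        ≡⟨ coeff-sumOf (filter P? (permutations N)) σ ⟩
  Σ[ filter P? (permutations N) ] (λ τ → 𝟏 (τ ≈? σ))  ≡⟨ Σ-filter P? (permutations N) (λ {τ} ¬p →
    cong (if_then 1ℤ else 0ℤ) (dec-false (τ ≈? σ) λ e → ¬p (Equivalence.from (P⇔Q e) q))) ⟩
  Σ[ permutations N ] (λ τ → 𝟏 (τ ≈? σ))              ≡⟨ Σ-permutations σ ⟩
  1ℤ                                                  ∎
  where open ≡-Reasoning
coeff-filter {N} P? (no ¬q) σ P⇔Q = trans (coeff-sumOf (filter P? (permutations N)) σ)
  (Σ-zero (filter P? (permutations N)) λ {τ} τ∈ → cong (if_then 1ℤ else 0ℤ)
    (dec-false (τ ≈? σ) λ e → ¬q (Equivalence.to (P⇔Q e) (proj₂ (∈-filter⁻ P? {xs = permutations N} τ∈)))))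

-- Partitions

partition-≡ : {μ ν : Partition} → parts μ ≡ parts ν → μ ≡ ν
partition-≡ {mkPartition xs d p} {mkPartition .xs d′ p′} refl =
  cong₂ (mkPartition xs) (Linked.irrelevant ℕ.≤-irrelevant d d′) (All.irrelevant nonZero-irrelevant p p′)
  where
  nonZero-irrelevant : ∀ {x} (p q : NonZero x) → p ≡ q
  nonZero-irrelevant {suc x} _ _ = refl

_≟ₚ_ : (μ ν : Partition) → Dec (μ ≡ ν)
μ ≟ₚ ν = map′ partition-≡ (cong parts) (List.≡-dec ℕ._≟_ (parts μ) (parts ν))

toPartition-just : ∀ xs {ν} → toPartition xs ≡ just ν → parts ν ≡ xs
toPartition-just xs eq with linked? ℕ._≥?_ xs | all? ℕ.nonZero? xs
toPartition-just xs refl | yes d | yes p = refl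
toPartition-just xs ()   | yes _ | no  _
toPartition-just xs ()   | no  _ | _

toPartition-parts : ∀ μ → toPartition (parts μ) ≡ just μ
toPartition-parts μ with linked? ℕ._≥?_ (parts μ) | all? ℕ.nonZero? (parts μ)
... | yes d | yes p = cong just (partition-≡ refl)
... | yes _ | no ¬p = contradiction (positive μ) ¬p
... | no ¬d | _     = contradiction (nonIncreasing μ) ¬d

-- In the next two lemmas f stands for the function local to compositions.

All-nonZero-step : (L : List (List ℕ)) (f : List ℕ → List ℕ) →
                   f [] ≡ [] → (∀ x xs → f (x ∷ xs) ≡ suc x ∷ xs) →
                   All (All NonZero) L → All (All NonZero) (map (1 ∷_) L ++ map f L)
All-nonZero-step L f f[] f∷ ps = All.++⁺ (All.map⁺ (All.map (_ ∷_) ps)) (All.map⁺ (All.map increment ps))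
  where
  increment : ∀ {xs} → All NonZero xs → All NonZero (f xs)
  increment []                          = subst (All NonZero) (sym f[]) []
  increment (_∷_ {x} {xs} _ ps′)        = subst (All NonZero) (sym (f∷ x xs)) (_ ∷ ps′)

Unique-step : (L : List (List ℕ)) (f : List ℕ → List ℕ) →
              f [] ≡ [] → (∀ x xs → f (x ∷ xs) ≡ suc x ∷ xs) →
              All (All NonZero) L → Unique L → Unique (map (1 ∷_) L ++ map f L)
Unique-step L f f[] f∷ ps uq =
  Unique.++⁺ (Unique.map⁺ List.∷-injectiveʳ uq) (Unique.map⁺ (f-injective _ _) uq) disjoint
  where
  f-injective : ∀ xs ys → f xs ≡ f ys → xs ≡ ys
  f-injective []       []       _  = refl
  f-injective []       (y ∷ ys) eq = contradiction (trans (sym f[]) (trans eq (f∷ y ys))) λ ()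
  f-injective (x ∷ xs) []       eq = contradiction (trans (sym (f∷ x xs)) (trans eq f[])) λ ()
  f-injective (x ∷ xs) (y ∷ ys) eq with trans (sym (f∷ x xs)) (trans eq (f∷ y ys))
  ... | refl = refl

  1∷≢f : ∀ {ys} zs → All NonZero zs → 1 ∷ ys ≢ f zs
  1∷≢f []           _  eq = contradiction (trans eq f[]) λ ()
  1∷≢f (zero ∷ zs)  (() ∷ _)
  1∷≢f (suc z ∷ zs) _  eq = contradiction (trans eq (f∷ (suc z) zs)) λ ()

  disjoint : ∀ {xs} → ¬ (xs ∈ map (1 ∷_) L × xs ∈ map f L)
  disjoint (∈₁ , ∈₂) with ∈-map⁻ (1 ∷_) ∈₁ | ∈-map⁻ f ∈₂
  ... | ys , _ , refl | zs , zs∈ , eq = 1∷≢f zs (All.lookup ps zs∈) eq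

compositions-nonZero : ∀ n → All (All NonZero) (compositions n)
compositions-nonZero zero          = [] ∷ []
compositions-nonZero (suc zero)    = (_ ∷ []) ∷ []
compositions-nonZero (suc (suc n)) = All-nonZero-step _ _ refl (λ _ _ → refl) (compositions-nonZero (suc n))

compositions-unique : ∀ n → Unique (compositions n)
compositions-unique zero          = [] ∷ []
compositions-unique (suc zero)    = [] ∷ []
compositions-unique (suc (suc n)) =
  Unique-step _ _ refl (λ _ _ → refl) (compositions-nonZero (suc n)) (compositions-unique (suc n))

∈-compositions : ∀ n xs → All NonZero xs → sumℕ xs ≡ n → xs ∈ compositions n
∈-compositions zero          []                 _        _  = here refl
∈-compositions zero          (zero ∷ _)         (() ∷ _) _
∈-compositions (suc zero)    (zero ∷ _)         (() ∷ _) _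
∈-compositions (suc zero)    (suc zero ∷ [])    _        _  = here refl
∈-compositions (suc zero)    (suc zero ∷ suc _ ∷ _) _    ()
∈-compositions (suc zero)    (suc zero ∷ zero ∷ _) (_ ∷ () ∷ _) _
∈-compositions (suc (suc n)) (zero ∷ _)         (() ∷ _) _
∈-compositions (suc (suc n)) (suc zero ∷ xs)    (_ ∷ ps) eq =
  ∈-++⁺ˡ (∈-map⁺ (1 ∷_) (∈-compositions (suc n) xs ps (ℕ.suc-injective eq)))
∈-compositions (suc (suc n)) (suc (suc x) ∷ xs) (_ ∷ ps) eq =
  ∈-++⁺ʳ (map (1 ∷_) (compositions (suc n)))
    (∈-map⁺ _ (∈-compositions (suc n) (suc x ∷ xs) (_ ∷ ps) (ℕ.suc-injective eq)))

Σ-mapMaybe : (h : A → Maybe B) (xs : List A) (f : B → ℤ) →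
             Σ[ mapMaybe h xs ] f ≡ Σ[ xs ] (maybe′ f 0ℤ ∘ h)
Σ-mapMaybe h []       f = refl
Σ-mapMaybe h (x ∷ xs) f with h x
... | just y  = cong (_+_ (f y)) (Σ-mapMaybe h xs f)
... | nothing = trans (Σ-mapMaybe h xs f) (sym (ℤ.+-identityˡ _))

-- Partitions are the compositions accepted by `toPartition`; with rejected ones counted as 0 the
-- sum runs over compositions, where the parts of μ occur just once.
Σ-partitions : ∀ {n} μ → sumℕ (parts μ) ≡ n → (f : Partition → ℤ) →
               (∀ {ν} → ν ≢ μ → f ν ≡ 0ℤ) → Σ[ partitions n ] f ≡ f μ
Σ-partitions {n} μ eq f f≗0 = begin
  Σ[ partitions n ] f
    ≡⟨ Σ-mapMaybe toPartition (compositions n) f ⟩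
  Σ[ compositions n ] (maybe′ f 0ℤ ∘ toPartition)
    ≡⟨ Σ-indicator (compositions-unique n) (∈-compositions n (parts μ) (positive μ) eq) (maybe′ f 0ℤ ∘ toPartition) vanishes ⟩
  maybe′ f 0ℤ (toPartition (parts μ))
    ≡⟨ cong (maybe′ f 0ℤ) (toPartition-parts μ) ⟩
  f μ ∎
  where
  open ≡-Reasoning
  vanishes : ∀ {xs} → xs ≢ parts μ → maybe′ f 0ℤ (toPartition xs) ≡ 0ℤ
  vanishes {xs} xs≢ with toPartition xs in eq′
  ... | nothing = refl
  ... | just ν  = f≗0 λ ν≡μ → xs≢ (trans (sym (toPartition-just xs eq′)) (cong parts ν≡μ))

-- Of all the class sums only the one of μ contains σ. The type is required of every τ `≈` σ because
-- `coeff` collects all such terms.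
coeff-expansion : (c : Partition → ℤ) {μ : Partition} → sumℕ (parts μ) ≡ n → (σ : Permutation′ (n ℕ.* 2)) →
                  (∀ {τ ν} → τ ≈ σ → HasCosetType n τ ν ⇔ ν ≡ μ) →
                  coeff (concatMap (λ ν → c ν • C n ν) (partitions n)) σ ≡ c μ
coeff-expansion {n} c {μ} |μ|≡n σ type = begin
  coeff (concatMap (λ ν → c ν • C n ν) (partitions n)) σ
    ≡⟨ coeff-concatMap (λ ν → c ν • C n ν) (partitions n) σ ⟩
  Σ[ partitions n ] (λ ν → coeff (c ν • C n ν) σ)
    ≡⟨ Σ-cong (partitions n) (λ {ν} _ → trans (coeff-• (c ν) (C n ν) σ)
         (cong (c ν *_) (coeff-filter (λ τ → hasCosetType? n τ ν) (ν ≟ₚ μ) σ (λ {τ} → type {τ})))) ⟩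
  Σ[ partitions n ] (λ ν → c ν * 𝟏 (ν ≟ₚ μ))
    ≡⟨ Σ-partitions μ |μ|≡n (λ ν → c ν * 𝟏 (ν ≟ₚ μ)) (λ {ν} ν≢μ →
         trans (cong (λ d → c ν * (if d then 1ℤ else 0ℤ)) (dec-false (ν ≟ₚ μ) ν≢μ)) (ℤ.*-zeroʳ (c ν))) ⟩
  c μ * 𝟏 (μ ≟ₚ μ)
    ≡⟨ cong (λ d → c μ * (if d then 1ℤ else 0ℤ)) (dec-true (μ ≟ₚ μ) refl) ⟩
  c μ * 1ℤ
    ≡⟨ ℤ.*-identityʳ (c μ) ⟩
  c μ ∎
  where open ≡-Reasoning

-- Letters

bar-combine : ∀ {n} (i : Fin n) (b : Fin 2) → bar {n} (combine i b) ≡ combine i (opposite b)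
bar-combine i b = cong (λ ib → combine (proj₁ ib) (opposite (proj₂ ib))) (Fin.remQuot-combine i b)

bar-involutive : ∀ {n} (x : Letter n) → bar {n} (bar {n} x) ≡ x
bar-involutive {n} x with Fin.combine-surjective {n} {2} x
... | i , b , refl = trans (cong (bar {n}) (bar-combine i b))
                       (trans (bar-combine i (opposite b)) (cong (combine i) (Fin.opposite-involutive b)))

x≢bar[x] : ∀ {n} (x : Letter n) → x ≢ bar {n} x
x≢bar[x] {n} x eq with Fin.combine-surjective {n} {2} x
... | i , b , refl = b≢opposite b (Fin.combine-injectiveʳ i b i (opposite b) (trans eq (bar-combine i b)))
  where
  b≢opposite : (b : Fin 2) → b ≢ opposite b
  b≢opposite zero       ()
  b≢opposite (suc zero) ()

bar-swap : ∀ {n} {x y : Letter n} → x ≡ bar {n} y → bar {n} x ≡ y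
bar-swap {n} refl = bar-involutive {n} _

bar-injective : ∀ {n} {x y : Letter n} → bar {n} x ≡ bar {n} y → x ≡ y
bar-injective {n} {x} {y} eq = trans (sym (bar-involutive {n} x)) (bar-swap {n} eq)

-- A list of letters stands for the solid edges starting at them; this gives both ends of each edge.
letters : ∀ {n} → List (Letter n) → List (Letter n)
letters         []       = []
letters {n = n} (x ∷ xs) = x ∷ bar {n} x ∷ letters {n} xs

module _ {n : ℕ} where

  letters-++ : (xs ys : List (Letter n)) → letters {n} (xs ++ ys) ≡ letters {n} xs ++ letters {n} ys
  letters-++ []       ys = refl
  letters-++ (x ∷ xs) ys = cong (λ zs → x ∷ bar {n} x ∷ zs) (letters-++ xs ys)

  letters-↭ : {xs ys : List (Letter n)} → xs ↭ ys → letters {n} xs ↭ letters {n} ys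
  letters-↭ Perm↭.refl          = ↭-refl
  letters-↭ (prep x p)          = prep x (prep _ (letters-↭ p))
  letters-↭ (swap {xs} {ys} x y p) = begin
    x ∷ bar {n} x ∷ y ∷ bar {n} y ∷ letters {n} xs
      ↭⟨ ↭.shifts (x ∷ bar {n} x ∷ []) (y ∷ bar {n} y ∷ []) ⟩
    y ∷ bar {n} y ∷ x ∷ bar {n} x ∷ letters {n} xs
      ↭⟨ prep _ (prep _ (prep _ (prep _ (letters-↭ p)))) ⟩
    y ∷ bar {n} y ∷ x ∷ bar {n} x ∷ letters {n} ys ∎
    where open PermutationReasoning
  letters-↭ (Perm↭.trans p q)   = ↭-trans (letters-↭ p) (letters-↭ q)

  letters-map-bar : (xs : List (Letter n)) → letters {n} (map (bar {n}) xs) ↭ letters {n} xs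
  letters-map-bar []       = ↭-refl
  letters-map-bar (x ∷ xs) rewrite bar-involutive {n} x = swap _ _ (letters-map-bar xs)

  ∈-letters : {x : Letter n} {xs : List (Letter n)} → x ∈ xs → x ∈ letters {n} xs
  ∈-letters (here refl) = here refl
  ∈-letters (there x∈)  = there (there (∈-letters x∈))

  bar∈-letters : {x : Letter n} {xs : List (Letter n)} → x ∈ xs → bar {n} x ∈ letters {n} xs
  bar∈-letters (here refl) = there (here refl)
  bar∈-letters (there x∈)  = there (there (bar∈-letters x∈))

  ∈-letters⁻ : {x : Letter n} (xs : List (Letter n)) → x ∈ letters {n} xs → x ∈ xs ⊎ ∃ λ z → z ∈ xs × x ≡ bar {n} z
  ∈-letters⁻ (_ ∷ xs) (here refl)         = inj₁ (here refl)
  ∈-letters⁻ (z ∷ xs) (there (here refl)) = inj₂ (z , here refl , refl)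
  ∈-letters⁻ (_ ∷ xs) (there (there x∈)) with ∈-letters⁻ xs x∈
  ... | inj₁ x∈′           = inj₁ (there x∈′)
  ... | inj₂ (z , z∈ , eq) = inj₂ (z , there z∈ , eq)

  length-letters : (xs : List (Letter n)) → length (letters {n} xs) ≡ 2 ℕ.* length xs
  length-letters []       = refl
  length-letters (x ∷ xs) = trans (cong (λ l → suc (suc l)) (length-letters xs)) (sym (ℕ.*-suc 2 (length xs)))

-- Chains of related elements

-- Both endpoints stay outside the list. Setting them equal closes the chain to a cycle, and
-- redirecting one of them is what a transposition does.
Chain : (A → A → Set) → A → List A → A → Set
Chain R a []       b = R a b
Chain R a (x ∷ xs) b = R a x × Chain R x xs b

module _ {R : A → A → Set} where

  chain-++⁺ : ∀ {a} xs {y} ys {b} → Chain R a xs y → Chain R y ys b → Chain R a (xs ++ y ∷ ys) b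
  chain-++⁺ []       ys r       rs′ = r , rs′
  chain-++⁺ (x ∷ xs) ys (r , rs) rs′ = r , chain-++⁺ xs ys rs rs′

  chain-++⁻ : ∀ {a} xs {y} ys {b} → Chain R a (xs ++ y ∷ ys) b → Chain R a xs y × Chain R y ys b
  chain-++⁻ []       ys (r , rs) = r , rs
  chain-++⁻ (x ∷ xs) ys (r , rs) with chain-++⁻ xs ys rs
  ... | rs₁ , rs₂ = (r , rs₁) , rs₂

  chain-reverse : (f : A → A) → (∀ {u v} → R u v → R (f v) (f u)) →
                  ∀ {a} xs {b} → Chain R a xs b → Chain R (f b) (reverse (map f xs)) (f a)
  chain-reverse f R-rev         []       r        = R-rev r
  chain-reverse f R-rev {a} (x ∷ xs) {b} (r , rs) =
    subst (λ zs → Chain R (f b) zs (f a)) (sym (List.unfold-reverse (f x) (map f xs)))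
      (chain-++⁺ (reverse (map f xs)) [] (chain-reverse f R-rev xs rs) (R-rev r))

  Cycle : List A → Set
  Cycle []       = ⊥
  Cycle (x ∷ xs) = Chain R x xs x

  cycle-rotate : ∀ as z bs → Cycle (as ++ z ∷ bs) → Cycle (z ∷ bs ++ as)
  cycle-rotate []       z bs c = subst (λ zs → Chain R z zs z) (sym (List.++-identityʳ bs)) c
  cycle-rotate (x ∷ as) z bs c with chain-++⁻ as bs c
  ... | c₁ , c₂ = chain-++⁺ bs as c₂ c₁

-- Cycle decompositions and the effect of a transposition on them

module _ {n : ℕ} where

  -- The two letters lie on different solid edges.
  Apart : Letter n → Letter n → Set
  Apart u v = u ≢ v × u ≢ bar {n} v

  apart-bar : ∀ {u v} → Apart u v → Apart (bar {n} u) v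
  apart-bar (u≢v , u≢v̄) = (λ eq → u≢v̄ (sym (bar-swap {n} (sym eq)))) , (λ eq → u≢v (bar-injective {n} eq))

  unique⇒apart : ∀ {x y zs} → Unique (letters {n} (x ∷ y ∷ zs)) →
                 Apart x y × (∀ {v} → v ∈ zs → Apart x v × Apart y v)
  unique⇒apart ((_ ∷ x≢y ∷ x≢ȳ ∷ x∉) ∷ _ ∷ (_ ∷ y∉) ∷ _) = (x≢y , x≢ȳ) , λ v∈ →
    (All.lookup x∉ (∈-letters {n} v∈) , All.lookup x∉ (bar∈-letters {n} v∈)) ,
    (All.lookup y∉ (∈-letters {n} v∈) , All.lookup y∉ (bar∈-letters {n} v∈))

  record Swaps (τ : Permutation′ (n ℕ.* 2)) (x y : Letter n) : Set where
    field
      x↦y   : τ ⟨$⟩ʳ x ≡ y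
      y↦x   : τ ⟨$⟩ʳ y ≡ x
      fixes : ∀ {v} → v ≢ x → v ≢ y → τ ⟨$⟩ʳ v ≡ v

  open Swaps

  Fixes : Permutation′ (n ℕ.* 2) → Letter n → Set
  Fixes τ v = τ ⟨$⟩ʳ v ≡ v × τ ⟨$⟩ʳ bar {n} v ≡ bar {n} v

  apart⇒fixes : ∀ {τ x y v} → Swaps τ x y → Apart x v → Apart y v → Fixes τ v
  apart⇒fixes s (x≢v , x≢v̄) (y≢v , y≢v̄) =
    fixes s (x≢v ∘ sym) (y≢v ∘ sym) , fixes s (x≢v̄ ∘ sym) (y≢v̄ ∘ sym)

  -- Cycles of the graph of σ, of which only the solid edges x x̄ oriented
  -- along the cycle are recorded, by their first ends x.
  Step : Permutation′ (n ℕ.* 2) → Letter n → Letter n → Set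
  Step σ u v = Dashed n σ (bar {n} u) v

  dashed-sym : ∀ {σ x y} → Dashed n σ x y → Dashed n σ y x
  dashed-sym {σ} (z , eq₁ , eq₂) = bar {n} z , eq₂ , trans eq₁ (cong (σ ⟨$⟩ʳ_) (sym (bar-involutive {n} z)))

  -- Since σ is injective, a letter lies on only one dashed edge.
  dashed-functional : ∀ {σ x y y′} → Dashed n σ x y → Dashed n σ x y′ → y ≡ y′
  dashed-functional {σ} (z , refl , refl) (z′ , eq , refl) = cong (λ w → σ ⟨$⟩ʳ bar {n} w)
    (trans (sym (Perm.inverseˡ σ)) (trans (cong (σ ⟨$⟩ˡ_) eq) (Perm.inverseˡ σ)))

  -- Left multiplication by τ moves the ends of the dashed edges and leaves the solid edges alone.
  dashed-act : ∀ {σ x y} τ → Dashed n σ x y → Dashed n (τ · σ) (τ ⟨$⟩ʳ x) (τ ⟨$⟩ʳ y)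
  dashed-act τ (z , eq₁ , eq₂) = z , cong (τ ⟨$⟩ʳ_) eq₁ , cong (τ ⟨$⟩ʳ_) eq₂

  step-reverse : ∀ {σ} {u v} → Step σ u v → Step σ (bar {n} v) (bar {n} u)
  step-reverse {σ} {u} {v} s =
    subst (λ w → Dashed n σ w (bar {n} u)) (sym (bar-involutive {n} v)) (dashed-sym {σ} s)

  -- If τ fixes both ends of every inner solid edge, it can move only the first and the last dashed
  -- end, at ā and at b; the chain is then attached to a′ and b′ instead.
  chain-act : ∀ {σ τ a a′ b b′} xs → τ ⟨$⟩ʳ bar {n} a ≡ bar {n} a′ → τ ⟨$⟩ʳ b ≡ b′ →
              (∀ {v} → v ∈ xs → Fixes τ v) → Chain (Step σ) a xs b → Chain (Step (τ · σ)) a′ xs b′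
  chain-act {σ} {τ} []       a↦ b↦ fix r        = subst₂ (Dashed n (τ · σ)) a↦ b↦ (dashed-act {σ} τ r)
  chain-act {σ} {τ} (x ∷ xs) a↦ b↦ fix (r , rs) =
    subst₂ (Dashed n (τ · σ)) a↦ (proj₁ (fix (here refl))) (dashed-act {σ} τ r) ,
    chain-act {σ} {τ} xs (proj₂ (fix (here refl))) b↦ (fix ∘ there) rs

  cycle-act : ∀ {σ τ} c → (∀ {v} → v ∈ c → Fixes τ v) → Cycle {R = Step σ} c → Cycle {R = Step (τ · σ)} c
  cycle-act {σ} {τ} (x ∷ xs) fix c =
    chain-act {σ} {τ} xs (proj₂ (fix (here refl))) (proj₁ (fix (here refl))) (fix ∘ there) c

  cycles-act : ∀ {σ τ} cs → (∀ {v} → v ∈ concat cs → Fixes τ v) →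
               All (Cycle {R = Step σ}) cs → All (Cycle {R = Step (τ · σ)}) cs
  cycles-act                 []       fix []       = []
  cycles-act {σ} {τ} (c ∷ cs) fix (p ∷ ps) =
    cycle-act {σ} {τ} c (fix ∘ ∈-++⁺ˡ) p ∷ cycles-act {σ} {τ} cs (fix ∘ ∈-++⁺ʳ c) ps

  -- Because `allFin` has no repetitions, `complete` says both that the cycles are disjoint and that
  -- they cover all letters.
  record Decomposition (σ : Permutation′ (n ℕ.* 2)) (cs : List (List (Letter n))) : Set where
    field
      cyclic   : All (Cycle {R = Step σ}) cs
      complete : letters {n} (concat cs) ↭ allFin (n ℕ.* 2)

  open Decomposition

  decomposition-unique : ∀ {σ cs} → Decomposition σ cs → Unique (letters {n} (concat cs))
  decomposition-unique D =
    ↭ₛ.Unique-resp-↭ (setoid _) (↭⇒↭ₛ (↭-sym (complete D))) (Unique.allFin⁺ _)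

  decomposition-↭ : ∀ {σ cs cs′} → cs ↭ cs′ → Decomposition σ cs → Decomposition σ cs′
  decomposition-↭ p D = record
    { cyclic   = All-resp-↭ p (cyclic D)
    ; complete = ↭-trans (letters-↭ {n} (concat-↭ (↭-sym p))) (complete D)
    }
    where
    concat-↭ : ∀ {css css′ : List (List (Letter n))} → css ↭ css′ → concat css ↭ concat css′
    concat-↭ Perm↭.refl        = ↭-refl
    concat-↭ (prep c q)        = ↭.++⁺ˡ c (concat-↭ q)
    concat-↭ (swap c d q)      = ↭-trans (↭.shifts c d) (↭.++⁺ˡ d (↭.++⁺ˡ c (concat-↭ q)))
    concat-↭ (Perm↭.trans q r) = ↭-trans (concat-↭ q) (concat-↭ r)

  module _ {σ τ : Permutation′ (n ℕ.* 2)} {x y : Letter n} (xs ys : List (Letter n)) {cs : List (List (Letter n))} where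

    private
      exposed : Unique (letters {n} (x ∷ xs ++ y ∷ ys ++ concat cs)) →
                Unique (letters {n} (x ∷ y ∷ xs ++ ys ++ concat cs))
      exposed = ↭ₛ.Unique-resp-↭ (setoid _) (↭⇒↭ₛ (letters-↭ {n} (prep x (↭.shift y xs _))))

    module _ (uq : Unique (letters {n} (x ∷ xs ++ y ∷ ys ++ concat cs))) (s : Swaps τ x y) where

      private
        x#y = proj₁ (unique⇒apart (exposed uq))
        fix : ∀ {v} → v ∈ xs ++ ys ++ concat cs → Fixes τ v
        fix v∈ = apart⇒fixes s (proj₁ #) (proj₂ #)
          where # = proj₂ (unique⇒apart (exposed uq)) v∈
        x̄-fixed : τ ⟨$⟩ʳ bar {n} x ≡ bar {n} x
        x̄-fixed = fixes s (x≢bar[x] {n} x ∘ sym) λ eq → proj₂ x#y (sym (bar-swap {n} (sym eq)))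
        ȳ-fixed : τ ⟨$⟩ʳ bar {n} y ≡ bar {n} y
        ȳ-fixed = fixes s (λ eq → proj₂ x#y (sym eq)) (x≢bar[x] {n} y ∘ sym)

      -- The dashed edge that returned to x now ends at y, and the one that returned to y ends at x,
      -- so the two closed chains run one after the other. `chain-cut` is the same exchange read
      -- backwards.
      chains-join : Chain (Step σ) x xs x → Chain (Step σ) y ys y → Chain (Step (τ · σ)) x (xs ++ y ∷ ys) x
      chains-join c d = chain-++⁺ xs ys
        (chain-act {σ} {τ} xs x̄-fixed (x↦y s) (fix ∘ ∈-++⁺ˡ) c)
        (chain-act {σ} {τ} ys ȳ-fixed (y↦x s) (fix ∘ ∈-++⁺ʳ xs ∘ ∈-++⁺ˡ) d)

      chain-cut : Chain (Step σ) x (xs ++ y ∷ ys) x → Chain (Step (τ · σ)) x xs x × Chain (Step (τ · σ)) y ys y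
      chain-cut c with chain-++⁻ xs ys c
      ... | c₁ , c₂ =
        chain-act {σ} {τ} xs x̄-fixed (y↦x s) (fix ∘ ∈-++⁺ˡ) c₁ ,
        chain-act {σ} {τ} ys ȳ-fixed (x↦y s) (fix ∘ ∈-++⁺ʳ xs ∘ ∈-++⁺ˡ) c₂

      others : All (Cycle {R = Step σ}) cs → All (Cycle {R = Step (τ · σ)}) cs
      others = cycles-act {σ} {τ} cs (fix ∘ ∈-++⁺ʳ xs ∘ ∈-++⁺ʳ ys)

    private
      assoc : letters {n} (x ∷ (xs ++ y ∷ ys) ++ concat cs) ≡ letters {n} (x ∷ xs ++ y ∷ ys ++ concat cs)
      assoc = cong (λ zs → letters {n} (x ∷ zs)) (List.++-assoc xs (y ∷ ys) (concat cs))

    join : Swaps τ x y → Decomposition σ ((x ∷ xs) ∷ (y ∷ ys) ∷ cs) →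
           Decomposition (τ · σ) ((x ∷ xs ++ y ∷ ys) ∷ cs)
    join s D@(record { cyclic = c ∷ d ∷ ps }) = record
      { cyclic   = chains-join uq s c d ∷ others uq s ps
      ; complete = ↭-trans (↭-reflexive assoc) (complete D)
      }
      where uq = decomposition-unique D

    cut : Swaps τ x y → Decomposition σ ((x ∷ xs ++ y ∷ ys) ∷ cs) →
          Decomposition (τ · σ) ((x ∷ xs) ∷ (y ∷ ys) ∷ cs)
    cut s D@(record { cyclic = c ∷ ps }) = record
      { cyclic   = proj₁ (chain-cut uq s c) ∷ proj₂ (chain-cut uq s c) ∷ others uq s ps
      ; complete = ↭-trans (↭-reflexive (sym assoc)) (complete D)
      }
      where uq = subst Unique assoc (decomposition-unique D)

    -- Here ȳ, the far end of the solid edge at y, changes places with x. After y ȳ the cycle runs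
    -- through the second half backwards, entering each solid edge at its other end; hence `ys` is
    -- reversed and barred.
    twist : Swaps τ x (bar {n} y) → Decomposition σ ((x ∷ xs ++ y ∷ ys) ∷ cs) →
            Decomposition (τ · σ) ((x ∷ xs ++ y ∷ reverse (map (bar {n}) ys)) ∷ cs)
    twist s D@(record { cyclic = c ∷ ps }) = record
      { cyclic   = chain-++⁺ xs (reverse (map (bar {n}) ys))
          (chain-act {σ} {τ} xs x̄-fixed y-fixed (fix ∘ ∈-++⁺ˡ) (proj₁ halves))
          -- The reversed half is a chain from x̄ to ȳ, whose outer dashed ends are x and ȳ. These
          -- are the two letters exchanged, so it becomes a chain from y to x.
          (chain-act {σ} {τ} (reverse (map (bar {n}) ys))
            (trans (cong (τ ⟨$⟩ʳ_) (bar-involutive {n} x)) (x↦y s)) (y↦x s) fix-reversed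
            (chain-reverse (bar {n}) (step-reverse {σ}) ys (proj₂ halves)))
          ∷ cycles-act {σ} {τ} cs (fix ∘ ∈-++⁺ʳ xs ∘ ∈-++⁺ʳ ys) ps
      ; complete = ↭-trans (prep _ (prep _ rearrange)) (↭-trans (↭-reflexive (sym assoc)) (complete D))
      }
      where
      uq  = exposed (subst Unique assoc (decomposition-unique D))
      x#y = proj₁ (unique⇒apart uq)
      halves = chain-++⁻ xs ys c
      fix : ∀ {v} → v ∈ xs ++ ys ++ concat cs → Fixes τ v
      fix v∈ = apart⇒fixes s (proj₁ #) (apart-bar (proj₂ #))
        where # = proj₂ (unique⇒apart uq) v∈
      x̄-fixed : τ ⟨$⟩ʳ bar {n} x ≡ bar {n} x
      x̄-fixed = fixes s (x≢bar[x] {n} x ∘ sym) λ eq → proj₁ x#y (bar-injective {n} eq)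
      y-fixed : τ ⟨$⟩ʳ y ≡ y
      y-fixed = fixes s (proj₁ x#y ∘ sym) (x≢bar[x] {n} y)
      fix-reversed : ∀ {v} → v ∈ reverse (map (bar {n}) ys) → Fixes τ v
      fix-reversed v∈ with ∈-map⁻ (bar {n}) (∈-resp-↭ (↭-reverse (map (bar {n}) ys)) v∈)
      ... | w , w∈ , refl = proj₂ fw , trans (cong (τ ⟨$⟩ʳ_) (bar-involutive {n} w))
                                         (trans (proj₁ fw) (sym (bar-involutive {n} w)))
        where fw = fix (∈-++⁺ʳ xs (∈-++⁺ˡ {ys = concat cs} w∈))
      rearrange : letters {n} ((xs ++ y ∷ reverse (map (bar {n}) ys)) ++ concat cs) ↭
                  letters {n} (xs ++ y ∷ ys ++ concat cs)
      rearrange = begin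
        letters {n} ((xs ++ y ∷ rs) ++ concat cs)
          ≡⟨ cong (letters {n}) (List.++-assoc xs (y ∷ rs) (concat cs)) ⟩
        letters {n} (xs ++ y ∷ rs ++ concat cs)
          ≡⟨ letters-++ {n} xs _ ⟩
        letters {n} xs ++ y ∷ bar {n} y ∷ letters {n} (rs ++ concat cs)
          ≡⟨ cong (λ zs → letters {n} xs ++ y ∷ bar {n} y ∷ zs) (letters-++ {n} rs _) ⟩
        letters {n} xs ++ y ∷ bar {n} y ∷ letters {n} rs ++ letters {n} (concat cs)
          ↭⟨ ↭.++⁺ˡ (letters {n} xs) (prep _ (prep _ (↭.++⁺ʳ (letters {n} (concat cs))
               (↭-trans (letters-↭ {n} (↭-reverse (map (bar {n}) ys))) (letters-map-bar {n} ys))))) ⟩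
        letters {n} xs ++ y ∷ bar {n} y ∷ letters {n} ys ++ letters {n} (concat cs)
          ≡⟨ cong (λ zs → letters {n} xs ++ y ∷ bar {n} y ∷ zs) (letters-++ {n} ys _) ⟨
        letters {n} xs ++ y ∷ bar {n} y ∷ letters {n} (ys ++ concat cs)
          ≡⟨ letters-++ {n} xs _ ⟨
        letters {n} (xs ++ y ∷ ys ++ concat cs) ∎
        where
        open PermutationReasoning
        rs = reverse (map (bar {n}) ys)

  rotate-to : ∀ {σ c j} → Cycle {R = Step σ} c → j ∈ c → ∃ λ c′ → Cycle {R = Step σ} (j ∷ c′) × j ∷ c′ ↭ c
  rotate-to {j = j} cyc j∈ with ∈-∃++ j∈
  ... | as , bs , refl = bs ++ as , cycle-rotate as j bs cyc , ↭.++-comm (j ∷ bs) as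

  -- If j is a recorded end, the cycle is rotated to it; otherwise j is a barred end and the cycle
  -- is first traversed in the opposite direction. Either way j becomes the head.
  enter-at : ∀ {σ} c {j} → Cycle {R = Step σ} c → j ∈ letters {n} c →
             ∃ λ c′ → Cycle {R = Step σ} (j ∷ c′) × letters {n} (j ∷ c′) ↭ letters {n} c × suc (length c′) ≡ length c
  enter-at {σ} (x ∷ xs) cyc j∈ with ∈-letters⁻ {n} (x ∷ xs) j∈
  ... | inj₁ j∈′ with rotate-to {σ} cyc j∈′
  ...   | c′ , cyc′ , p = c′ , cyc′ , letters-↭ {n} p , ↭.↭-length p
  enter-at {σ} (x ∷ xs) cyc j∈ | inj₂ (z , z∈ , refl)
    with rotate-to {σ} {bar {n} x ∷ reverse (map (bar {n}) xs)} (chain-reverse (bar {n}) (step-reverse {σ}) xs cyc)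
           (∈-resp-↭ (prep _ (↭-sym (↭-reverse (map (bar {n}) xs)))) (∈-map⁺ (bar {n}) z∈))
  ... | c′ , cyc′ , p = c′ , cyc′ , ↭-trans (letters-↭ {n} p′) (letters-map-bar {n} (x ∷ xs)) ,
                        trans (↭.↭-length p′) (List.length-map (bar {n}) (x ∷ xs))
    where p′ = ↭-trans p (prep _ (↭-reverse (map (bar {n}) xs)))

  -- Brings the cycle of j into the form that `join` expects: second in the list, with j at its
  -- head.
  expose : ∀ {σ c₀ cs c j} → Decomposition σ (c₀ ∷ cs) → c ∈ cs → j ∈ letters {n} c →
           ∃₂ λ c′ cs′ → Decomposition σ (c₀ ∷ (j ∷ c′) ∷ cs′) × suc (length c′) ≡ length c × cs ↭ c ∷ cs′
  expose {σ} {c₀} {cs} {c} {j} D c∈ j∈ with ∈-∃++ c∈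
  ... | as , bs , refl with decomposition-↭ (prep c₀ (↭.shift c as bs)) D
  ...   | D′@(record { cyclic = cyc₀ ∷ cyc ∷ ps }) with enter-at {σ} c cyc j∈
  ...     | c′ , cyc′ , p , len = c′ , as ++ bs , record
    { cyclic   = cyc₀ ∷ cyc′ ∷ ps
    ; complete = ↭-trans (begin
        letters {n} (c₀ ++ (j ∷ c′) ++ rest)                       ≡⟨ split (j ∷ c′) ⟩
        letters {n} c₀ ++ letters {n} (j ∷ c′) ++ letters {n} rest ↭⟨ ↭.++⁺ˡ (letters {n} c₀) (↭.++⁺ʳ (letters {n} rest) p) ⟩
        letters {n} c₀ ++ letters {n} c ++ letters {n} rest        ≡⟨ split c ⟨
        letters {n} (c₀ ++ c ++ rest)                              ∎) (complete D′)
    } , len , ↭.shift c as bs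
    where
    open PermutationReasoning
    rest = concat (as ++ bs)
    split : ∀ d → letters {n} (c₀ ++ d ++ rest) ≡ letters {n} c₀ ++ letters {n} d ++ letters {n} rest
    split d = trans (letters-++ {n} c₀ _) (cong (letters {n} c₀ ++_) (letters-++ {n} d rest))

-- Coset-types

sameMembers⇒↭ : {xs ys : List A} → Unique xs → Unique ys →
                (∀ {z} → z ∈ xs → z ∈ ys) → (∀ {z} → z ∈ ys → z ∈ xs) → xs ↭ ys
sameMembers⇒↭ uxs uys to from = ∼bag⇒↭ (unique∧set⇒bag uxs uys (mk⇔ to from))

minimum : (x : Fin N) (xs : List (Fin N)) → ∃ λ m → m ∈ x ∷ xs × (∀ {y} → y ∈ x ∷ xs → m Fin.≤ y)
minimum {N} x xs = min x xs , min∈ , λ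
  { (here refl) → f[argmin]≤f[⊤] {f = λ y → y} x xs
  ; (there y∈)  → All.lookup (f[argmin]≤f[xs] {f = λ y → y} x xs) y∈ }
  where
  open Extrema (Fin.≤-totalOrder N)
  min∈ : min x xs ∈ x ∷ xs
  min∈ with argmin-sel (λ y → y) x xs
  ... | inj₁ eq = here eq
  ... | inj₂ m∈ = there m∈

-- Used with `isLeast?` on the letters of one cycle, so that each cycle contributes exactly one
-- length.
filter-minimum : {P : Fin N → Set} (P? : ∀ x → Dec (P x)) (x : Fin N) (xs : List (Fin N)) → Unique (x ∷ xs) →
                 (∀ {z} → z ∈ x ∷ xs → P z ⇔ (∀ y → y ∈ x ∷ xs → z Fin.≤ y)) →
                 ∃ λ m → m ∈ x ∷ xs × filter P? (x ∷ xs) ≡ [ m ]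
filter-minimum P? x xs uq P⇔ with minimum x xs
... | m , m∈ , m≤ = m , m∈ , ↭.↭-singleton-inv
  (sameMembers⇒↭ (Unique.filter⁺ P? uq) ([] ∷ [])
    (λ z∈ → let z∈′ , pz = ∈-filter⁻ P? {xs = x ∷ xs} z∈ in
            here (Fin.≤-antisym (Equivalence.to (P⇔ z∈′) pz m m∈) (m≤ z∈′)))
    (λ { (here refl) → ∈-filter⁺ P? m∈ (Equivalence.from (P⇔ m∈) (λ _ → m≤)) }))

module _ {R : A → A → Set} where

  chain-successor : ∀ {a} xs {b v} → Chain R a xs b → v ∈ a ∷ xs → ∃ λ w → (w ≡ b ⊎ w ∈ xs) × R v w
  chain-successor []       r        (here refl) = _ , inj₁ refl , r
  chain-successor (x ∷ xs) (r , rs) (here refl) = x , inj₂ (here refl) , r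
  chain-successor (x ∷ xs) (r , rs) (there v∈)  with chain-successor xs rs v∈
  ... | w , inj₁ eq , r′ = w , inj₁ eq , r′
  ... | w , inj₂ w∈ , r′ = w , inj₂ (there w∈) , r′

  chain-predecessor : ∀ {a} xs {b v} → Chain R a xs b → v ≡ b ⊎ v ∈ xs → ∃ λ u → u ∈ a ∷ xs × R u v
  chain-predecessor []       r        (inj₁ refl) = _ , here refl , r
  chain-predecessor (x ∷ xs) (r , rs) (inj₂ (here refl)) = _ , here refl , r
  chain-predecessor (x ∷ xs) (r , rs) (inj₁ refl) with chain-predecessor xs rs (inj₁ refl)
  ... | u , u∈ , r′ = u , there u∈ , r′
  chain-predecessor (x ∷ xs) (r , rs) (inj₂ (there v∈)) with chain-predecessor xs rs (inj₂ v∈)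
  ... | u , u∈ , r′ = u , there u∈ , r′

  cycle-successor : ∀ {c v} → Cycle {R = R} c → v ∈ c → ∃ λ w → w ∈ c × R v w
  cycle-successor {x ∷ xs} cyc v∈ with chain-successor xs cyc v∈
  ... | w , inj₁ refl , r = w , here refl , r
  ... | w , inj₂ w∈   , r = w , there w∈ , r

  cycle-predecessor : ∀ {c v} → Cycle {R = R} c → v ∈ c → ∃ λ u → u ∈ c × R u v
  cycle-predecessor {x ∷ xs} cyc (here refl) = chain-predecessor xs cyc (inj₁ refl)
  cycle-predecessor {x ∷ xs} cyc (there v∈)  = chain-predecessor xs cyc (inj₂ v∈)

module _ {n : ℕ} {σ : Permutation′ (n ℕ.* 2)} where

  adjacent-sym : ∀ {x y} → Adjacent n σ x y → Adjacent n σ y x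
  adjacent-sym (inj₁ refl) = inj₁ (sym (bar-involutive {n} _))
  adjacent-sym (inj₂ d)    = inj₂ (dashed-sym {n} {σ} d)

  -- The dashed edge at a recorded end comes from the predecessor on the cycle, the one at a barred
  -- end leads to the successor, and there are no others by `dashed-functional`.
  cycle-closed : ∀ {c y z} → Cycle {R = Step {n} σ} c → y ∈ letters {n} c → Adjacent n σ y z → z ∈ letters {n} c
  cycle-closed {c} cyc y∈ adj with ∈-letters⁻ {n} c y∈ | adj
  ... | inj₁ y∈′              | inj₁ refl = bar∈-letters {n} y∈′
  ... | inj₂ (w , w∈ , refl)  | inj₁ refl = subst (_∈ letters {n} c) (sym (bar-involutive {n} w)) (∈-letters {n} w∈)
  ... | inj₁ y∈′              | inj₂ d with cycle-predecessor {R = Step {n} σ} {c} cyc y∈′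
  ...   | u , u∈ , s = subst (_∈ letters {n} c) (dashed-functional {n} {σ} (dashed-sym {n} {σ} s) d) (bar∈-letters {n} u∈)
  cycle-closed {c} cyc y∈ adj | inj₂ (w , w∈ , refl) | inj₂ d with cycle-successor {R = Step {n} σ} {c} cyc w∈
  ...   | v , v∈ , s = subst (_∈ letters {n} c) (dashed-functional {n} {σ} s d) (∈-letters {n} v∈)

  chain-connected : ∀ {a} xs {b y} → Chain (Step {n} σ) a xs b → y ∈ letters {n} (a ∷ xs) → Connected n σ a y
  chain-connected xs       rs       (here refl)         = ε
  chain-connected xs       rs       (there (here refl)) = inj₁ refl ◅ ε
  chain-connected (x ∷ xs) (r , rs) (there (there y∈))  = inj₁ refl ◅ inj₂ r ◅ chain-connected xs rs y∈

  cycle-component : ∀ {c y z} → Cycle {R = Step {n} σ} c → y ∈ letters {n} c → Connected n σ y z ⇔ z ∈ letters {n} c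
  cycle-component {c@(x ∷ xs)} cyc y∈ = mk⇔ (closed y∈) λ z∈ →
    Star.reverse adjacent-sym (chain-connected xs cyc y∈) ◅◅ chain-connected xs cyc z∈
    where
    closed : ∀ {y z} → y ∈ letters {n} c → Connected n σ y z → z ∈ letters {n} c
    closed y∈ ε        = y∈
    closed y∈ (a ◅ as) = closed (cycle-closed {c} cyc y∈ a) as

  private
    size : Letter n → ℕ
    size x = length (filter (connected? n σ x) (allFin (n ℕ.* 2)))

  size-cycle : ∀ {c y} → Cycle {R = Step {n} σ} c → Unique (letters {n} c) → y ∈ letters {n} c → size y ≡ 2 ℕ.* length c
  size-cycle {c} {y} cyc uq y∈ = trans
    (↭.↭-length (sameMembers⇒↭ (Unique.filter⁺ (connected? n σ y) (Unique.allFin⁺ _)) uq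
      (λ z∈ → Equivalence.to (cycle-component {c} cyc y∈) (proj₂ (∈-filter⁻ (connected? n σ y) {xs = allFin (n ℕ.* 2)} z∈)))
      (λ z∈ → ∈-filter⁺ (connected? n σ y) (∈-allFin _) (Equivalence.from (cycle-component {c} cyc y∈) z∈))))
    (length-letters {n} c)

  least-sizes : ∀ cs → All (Cycle {R = Step {n} σ}) cs → Unique (letters {n} (concat cs)) →
                map size (filter (isLeast? n σ) (letters {n} (concat cs))) ≡ map (λ c → 2 ℕ.* length c) cs
  least-sizes []                  []         uq = refl
  least-sizes (c@(x ∷ xs) ∷ cs) (cyc ∷ ps) uq = begin
    map size (filter (isLeast? n σ) (letters {n} (c ++ concat cs)))
      ≡⟨ cong (λ zs → map size (filter (isLeast? n σ) zs)) (letters-++ {n} c (concat cs)) ⟩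
    map size (filter (isLeast? n σ) (letters {n} c ++ letters {n} (concat cs)))
      ≡⟨ cong (map size) (List.filter-++ (isLeast? n σ) (letters {n} c) _) ⟩
    map size (filter (isLeast? n σ) (letters {n} c) ++ filter (isLeast? n σ) (letters {n} (concat cs)))
      ≡⟨ List.map-++ size (filter (isLeast? n σ) (letters {n} c)) _ ⟩
    map size (filter (isLeast? n σ) (letters {n} c)) ++ map size (filter (isLeast? n σ) (letters {n} (concat cs)))
      ≡⟨ cong₂ (λ ys zs → map size ys ++ zs) (proj₂ (proj₂ least)) (least-sizes cs ps (proj₂ uniques)) ⟩
    size (proj₁ least) ∷ map (λ c → 2 ℕ.* length c) cs
      ≡⟨ cong (_∷ _) (size-cycle {c} cyc (proj₁ uniques) (proj₁ (proj₂ least))) ⟩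
    map (λ c → 2 ℕ.* length c) (c ∷ cs) ∎
    where
    open ≡-Reasoning
    uniques : Unique (letters {n} c) × Unique (letters {n} (concat cs))
    uniques = unique-++⁻ (letters {n} c) (subst Unique (letters-++ {n} c (concat cs)) uq)
      where
      unique-++⁻ : (ys : List A) {zs : List A} → Unique (ys ++ zs) → Unique ys × Unique zs
      unique-++⁻ []       uq       = [] , uq
      unique-++⁻ (y ∷ ys) (y∉ ∷ uq) with unique-++⁻ ys uq
      ... | uys , uzs = All.++⁻ˡ ys y∉ ∷ uys , uzs
    least = filter-minimum (isLeast? n σ) x (bar {n} x ∷ letters {n} xs) (proj₁ uniques) λ z∈ → mk⇔
      (λ z≤ y y∈ → z≤ y (Equivalence.from (cycle-component {c} cyc z∈) y∈))
      (λ z≤ y con → z≤ y (Equivalence.to (cycle-component {c} cyc z∈) con))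

  -- `cycleLengths` scans the letters in their natural order. Rearranged cycle by cycle, each cycle
  -- has one least letter, whose component is the whole cycle.
  cycleLengths-↭ : ∀ {cs} → Decomposition {n} σ cs → cycleLengths n σ ↭ map (λ c → 2 ℕ.* length c) cs
  cycleLengths-↭ {cs} D = ↭-trans
    (↭.map⁺ size (filter-↭ (isLeast? n σ) (↭-sym (Decomposition.complete D))))
    (↭-reflexive (least-sizes cs (Decomposition.cyclic D) (decomposition-unique {n} D)))

  decomposition-size : ∀ {cs} → Decomposition {n} σ cs → sumℕ (map length cs) ≡ n
  decomposition-size {cs} D = ℕ.*-cancelˡ-≡ (sumℕ (map length cs)) n 2 (begin
    2 ℕ.* sumℕ (map length cs)      ≡⟨ cong (2 ℕ.*_) (length-concat cs) ⟨
    2 ℕ.* length (concat cs)        ≡⟨ length-letters {n} (concat cs) ⟨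
    length (letters {n} (concat cs)) ≡⟨ ↭.↭-length (Decomposition.complete D) ⟩
    length (allFin (n ℕ.* 2))       ≡⟨ List.length-tabulate {n = n ℕ.* 2} (λ i → i) ⟩
    n ℕ.* 2                         ≡⟨ ℕ.*-comm n 2 ⟩
    2 ℕ.* n                         ∎)
    where
    open ≡-Reasoning
    length-concat : (xss : List (List A)) → length (concat xss) ≡ sumℕ (map length xss)
    length-concat []         = refl
    length-concat (xs ∷ xss) = trans (List.length-++ xs) (cong (length xs ℕ.+_) (length-concat xss))

sorted-↭⇒≡ : {xs ys : List ℕ} → Linked _≥_ xs → Linked _≥_ ys → xs ↭ ys → xs ≡ ys
sorted-↭⇒≡ xs↘ ys↘ p = Pointwise-≡⇒≡ (↗↭↗⇒≋ (Flip.totalOrder ℕ.≤-totalOrder) xs↘ ys↘ (↭⇒↭ₛ p))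

-- Both sides are weakly decreasing rearrangements of the same list, hence equal, and doubling is
-- injective.
decomposition⇒type : ∀ {n σ cs} → Decomposition {n} σ cs → ∀ {μ} → map length cs ↭ parts μ →
                     ∀ {ν} → HasCosetType n σ ν ⇔ ν ≡ μ
decomposition⇒type {n} {σ} {cs} D {μ} p = mk⇔
  (λ h → partition-≡ (List.map-injective (ℕ.*-cancelˡ-≡ _ _ 2) (trans (sym h) type)))
  (λ { refl → type })
  where
  type : sort≥ (cycleLengths n σ) ≡ map (2 ℕ.*_) (parts μ)
  type = sorted-↭⇒≡ (sort≥-↘ (cycleLengths n σ))
    (Linked.map⁺ (Linked.map (ℕ.*-monoʳ-≤ 2) (nonIncreasing μ)))
    (begin
      sort≥ (cycleLengths n σ)                ↭⟨ sort≥-↭ (cycleLengths n σ) ⟩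
      cycleLengths n σ                        ↭⟨ cycleLengths-↭ D ⟩
      map (λ c → 2 ℕ.* length c) cs           ≡⟨ List.map-∘ cs ⟩
      map (2 ℕ.*_) (map length cs)            ↭⟨ ↭.map⁺ (2 ℕ.*_) p ⟩
      map (2 ℕ.*_) (parts μ)                  ∎)
    where open PermutationReasoning

decomposition-≈ : ∀ {n σ τ cs} → τ ≈ σ → Decomposition {n} σ cs → Decomposition {n} τ cs
decomposition-≈ {n} {σ} {τ} τ≈σ D = record
  { cyclic   = All.map (λ {c} → cycle-≈ c) (Decomposition.cyclic D)
  ; complete = Decomposition.complete D
  }
  where
  chain-≈ : ∀ {a} xs {b} → Chain (Step {n} σ) a xs b → Chain (Step {n} τ) a xs b
  chain-≈ []       (z , eq₁ , eq₂)        = z , trans eq₁ (sym (τ≈σ _)) , trans eq₂ (sym (τ≈σ _))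
  chain-≈ (x ∷ xs) ((z , eq₁ , eq₂) , rs) = (z , trans eq₁ (sym (τ≈σ _)) , trans eq₂ (sym (τ≈σ _))) , chain-≈ xs rs
  cycle-≈ : ∀ c → Cycle {R = Step {n} σ} c → Cycle {R = Step {n} τ} c
  cycle-≈ (x ∷ xs) = chain-≈ xs

coeff-decomposition : ∀ {n σ cs} → Decomposition {n} σ cs → (c : Partition → ℤ) → ∀ {μ} → map length cs ↭ parts μ →
                      coeff (concatMap (λ ν → c ν • C n ν) (partitions n)) σ ≡ c μ
coeff-decomposition {n} {σ} D c {μ} p =
  coeff-expansion c (trans (sum-↭ (↭-sym p)) (decomposition-size D)) σ
    λ {τ} {ν} τ≈σ → decomposition⇒type {σ = τ} (decomposition-≈ {σ = σ} {τ} τ≈σ D) {μ} p {ν}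

-- Adjoining the letters of a new index

module _ {n : ℕ} where

  inj : Letter n → Letter (suc n)
  inj x = inject₁ (inject₁ x)

  inj-injective : ∀ {x y} → inj x ≡ inj y → x ≡ y
  inj-injective = Fin.inject₁-injective ∘ Fin.inject₁-injective

  toℕ-inj : ∀ x → toℕ (inj x) ≡ toℕ x
  toℕ-inj x = trans (Fin.toℕ-inject₁ (inject₁ x)) (Fin.toℕ-inject₁ x)

  inj-combine : ∀ (i : Fin n) (b : Fin 2) → inj (combine i b) ≡ combine (inject₁ i) b
  inj-combine i b = Fin.toℕ-injective (begin
    toℕ (inj (combine i b))           ≡⟨ toℕ-inj (combine i b) ⟩
    toℕ (combine i b)                 ≡⟨ Fin.toℕ-combine i b ⟩
    2 ℕ.* toℕ i ℕ.+ toℕ b             ≡⟨ cong (λ t → 2 ℕ.* t ℕ.+ toℕ b) (Fin.toℕ-inject₁ i) ⟨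
    2 ℕ.* toℕ (inject₁ i) ℕ.+ toℕ b   ≡⟨ Fin.toℕ-combine (inject₁ i) b ⟨
    toℕ (combine (inject₁ i) b)       ∎)
    where open ≡-Reasoning

  inj-bar : ∀ x → inj (bar {n} x) ≡ bar {suc n} (inj x)
  inj-bar x with Fin.combine-surjective {n} {2} x
  ... | i , b , refl = begin
    inj (bar {n} (combine i b))           ≡⟨ cong inj (bar-combine i b) ⟩
    inj (combine i (opposite b))          ≡⟨ inj-combine i (opposite b) ⟩
    combine (inject₁ i) (opposite b)      ≡⟨ bar-combine (inject₁ i) b ⟨
    bar {suc n} (combine (inject₁ i) b)   ≡⟨ cong (bar {suc n}) (inj-combine i b) ⟨
    bar {suc n} (inj (combine i b))       ∎
    where open ≡-Reasoning

  top top̄ : Letter (suc n)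
  top = plain (fromℕ n)
  top̄ = bar {suc n} top

  toℕ-top : toℕ top ≡ n ℕ.* 2
  toℕ-top = begin
    toℕ top                         ≡⟨ Fin.toℕ-combine (fromℕ n) (zero {1}) ⟩
    2 ℕ.* toℕ (fromℕ n) ℕ.+ 0       ≡⟨ ℕ.+-identityʳ _ ⟩
    2 ℕ.* toℕ (fromℕ n)             ≡⟨ cong (2 ℕ.*_) (Fin.toℕ-fromℕ n) ⟩
    2 ℕ.* n                         ≡⟨ ℕ.*-comm 2 n ⟩
    n ℕ.* 2                         ∎
    where open ≡-Reasoning

  toℕ-top̄ : toℕ top̄ ≡ suc (n ℕ.* 2)
  toℕ-top̄ = begin
    toℕ top̄                            ≡⟨ cong toℕ (bar-combine (fromℕ n) zero) ⟩
    toℕ (combine (fromℕ n) (suc (zero {0}))) ≡⟨ Fin.toℕ-combine (fromℕ n) (suc (zero {0})) ⟩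
    2 ℕ.* toℕ (fromℕ n) ℕ.+ 1          ≡⟨ ℕ.+-comm _ 1 ⟩
    suc (2 ℕ.* toℕ (fromℕ n))          ≡⟨ cong (λ t → suc (2 ℕ.* t)) (Fin.toℕ-fromℕ n) ⟩
    suc (2 ℕ.* n)                      ≡⟨ cong suc (ℕ.*-comm 2 n) ⟩
    suc (n ℕ.* 2)                      ∎
    where open ≡-Reasoning

  -- `plain` places letters by arithmetic on indices, whereas `inj` and later `extend` treat the new
  -- letters as the last two positions; the two descriptions are matched by value.
  top≡ : top ≡ inject₁ (fromℕ (n ℕ.* 2))
  top≡ = Fin.toℕ-injective (trans toℕ-top
    (sym (trans (Fin.toℕ-inject₁ (fromℕ (n ℕ.* 2))) (Fin.toℕ-fromℕ (n ℕ.* 2)))))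

  top̄≡ : top̄ ≡ fromℕ (suc (n ℕ.* 2))
  top̄≡ = Fin.toℕ-injective (trans toℕ-top̄ (sym (Fin.toℕ-fromℕ (suc (n ℕ.* 2)))))

  inj<top : ∀ x → inj x Fin.< top
  inj<top x = subst₂ ℕ._<_ (sym (toℕ-inj x)) (sym toℕ-top) (Fin.toℕ<n x)

  <top⇒≢ : ∀ {y} → y Fin.< top → y ≢ top × y ≢ top̄
  <top⇒≢ y< = (λ { refl → ℕ.<-irrefl refl y< }) , λ { refl →
    ℕ.<-irrefl refl (ℕ.<-trans y< (subst₂ ℕ._<_ (sym toℕ-top) (sym toℕ-top̄) (ℕ.n<1+n _))) }

  data OldOrNew : Letter (suc n) → Set where
    old  : ∀ x → OldOrNew (inj x)
    new  : OldOrNew top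
    new̄  : OldOrNew top̄

  oldOrNew : ∀ y → OldOrNew y
  oldOrNew y with view y
  ... | ‵fromℕ = subst OldOrNew top̄≡ new̄
  ... | ‵inject₁ z with view z
  ...   | ‵fromℕ     = subst OldOrNew top≡ new
  ...   | ‵inject₁ x = old x

  allFin-suc : allFin (suc n ℕ.* 2) ↭ top ∷ top̄ ∷ map inj (allFin (n ℕ.* 2))
  allFin-suc = sameMembers⇒↭ (Unique.allFin⁺ _)
    ((x≢bar[x] {suc n} top ∷ fresh (λ x eq → proj₁ (<top⇒≢ (inj<top x)) (sym eq))) ∷
     fresh (λ x eq → proj₂ (<top⇒≢ (inj<top x)) (sym eq)) ∷
     Unique.map⁺ (inj-injective) (Unique.allFin⁺ _))
    (λ {y} _ → ∈₁ (oldOrNew y)) (λ {y} _ → ∈-allFin y)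
    where
    fresh : ∀ {y} → (∀ x → y ≢ inj x) → All (y ≢_) (map inj (allFin (n ℕ.* 2)))
    fresh y≢ = All.map⁺ (All.tabulate λ {x} _ → y≢ x)
    ∈₁ : ∀ {y} → OldOrNew y → y ∈ top ∷ top̄ ∷ map inj (allFin (n ℕ.* 2))
    ∈₁ (old x) = there (there (∈-map⁺ inj (∈-allFin x)))
    ∈₁ new     = here refl
    ∈₁ new̄     = there (here refl)

  letters-map-inj : ∀ xs → letters {suc n} (map inj xs) ≡ map inj (letters {n} xs)
  letters-map-inj []       = refl
  letters-map-inj (x ∷ xs) = cong₂ (λ y zs → inj x ∷ y ∷ zs) (sym (inj-bar x)) (letters-map-inj xs)

below : (i : Fin n) → List (Letter n)
below {n} i = filter (Fin._<? plain i) (allFin (n ℕ.* 2))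

module _ {n : ℕ} where

  below-inject₁ : ∀ (i : Fin n) → below (inject₁ i) ↭ map (inj {n}) (below i)
  below-inject₁ i = sameMembers⇒↭ (Unique.filter⁺ (Fin._<? plain (inject₁ i)) (Unique.allFin⁺ _))
    (Unique.map⁺ (inj-injective {n}) (Unique.filter⁺ (Fin._<? plain i) (Unique.allFin⁺ _)))
    (λ {y} y∈ → to (oldOrNew {n} y) (proj₂ (∈-filter⁻ (Fin._<? plain (inject₁ i)) {xs = allFin _} y∈)))
    from
    where
    plain-inject₁ : toℕ (plain (inject₁ i)) ≡ toℕ (plain i)
    plain-inject₁ = trans (cong toℕ (sym (inj-combine i zero))) (toℕ-inj {n} (plain i))
    <top : ∀ {y} → y Fin.< plain (inject₁ i) → y Fin.< top {n}
    <top y< = ℕ.<-trans y< (subst (Fin._< top {n}) (inj-combine i zero) (inj<top {n} (plain i)))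
    to : ∀ {y} → OldOrNew {n} y → y Fin.< plain (inject₁ i) → y ∈ map (inj {n}) (below i)
    to (old x) y< = ∈-map⁺ (inj {n}) (∈-filter⁺ (Fin._<? plain i) (∈-allFin x) (subst₂ ℕ._<_ (toℕ-inj {n} x) plain-inject₁ y<))
    to new     y< = contradiction refl (proj₁ (<top⇒≢ {n} (<top y<)))
    to new̄     y< = contradiction refl (proj₂ (<top⇒≢ {n} (<top y<)))
    from : ∀ {y} → y ∈ map (inj {n}) (below i) → y ∈ below (inject₁ i)
    from y∈ with ∈-map⁻ (inj {n}) y∈
    ... | x , x∈ , refl = ∈-filter⁺ (Fin._<? plain (inject₁ i)) (∈-allFin _)
      (subst₂ ℕ._<_ (sym (toℕ-inj {n} x)) (sym plain-inject₁) (proj₂ (∈-filter⁻ (Fin._<? plain i) {xs = allFin _} x∈)))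

  below-top : below (fromℕ n) ↭ map (inj {n}) (allFin (n ℕ.* 2))
  below-top = sameMembers⇒↭ (Unique.filter⁺ (Fin._<? top {n}) (Unique.allFin⁺ _))
    (Unique.map⁺ (inj-injective {n}) (Unique.allFin⁺ _))
    (λ {y} y∈ → to (oldOrNew {n} y) (proj₂ (∈-filter⁻ (Fin._<? top {n}) {xs = allFin _} y∈)))
    from
    where
    to : ∀ {y} → OldOrNew {n} y → y Fin.< top {n} → y ∈ map (inj {n}) (allFin (n ℕ.* 2))
    to (old x) _  = ∈-map⁺ (inj {n}) (∈-allFin x)
    to new     y< = contradiction refl (proj₁ (<top⇒≢ {n} y<))
    to new̄     y< = contradiction refl (proj₂ (<top⇒≢ {n} y<))
    from : ∀ {y} → y ∈ map (inj {n}) (allFin (n ℕ.* 2)) → y ∈ below (fromℕ n)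
    from y∈ with ∈-map⁻ (inj {n}) y∈
    ... | x , _ , refl = ∈-filter⁺ (Fin._<? top {n}) (∈-allFin _) (inj<top {n} x)

  -- The letters below `top` are all but `top` and `top̄`, which head the first cycle; cancelling
  -- them in `complete` lists the j of J_{n+1} by cycles.
  below-top-letters : ∀ {σ xs cs} → Decomposition {suc n} σ ((top {n} ∷ xs) ∷ cs) →
                      below (fromℕ n) ↭ letters {suc n} (xs ++ concat cs)
  below-top-letters D = ↭-trans below-top
    (drop-∷ (drop-∷ (↭-trans (↭-sym (allFin-suc {n})) (↭-sym (Decomposition.complete D)))))

  below-inject₁≢ : ∀ {i : Fin n} {j} → j ∈ below (inject₁ i) → j ≢ top {n} × j ≢ top̄ {n}
  below-inject₁≢ {i} j∈ with ∈-map⁻ (inj {n}) (∈-resp-↭ (below-inject₁ i) j∈)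
  ... | x , _ , refl = <top⇒≢ {n} (inj<top {n} x)

-- Permutations fixing the letters of the new index

punchIn-fromℕ : ∀ (k : Fin N) → punchIn (fromℕ N) k ≡ inject₁ k
punchIn-fromℕ zero    = refl
punchIn-fromℕ (suc k) = cong suc (punchIn-fromℕ k)

extend : Permutation′ N → Permutation′ (suc N)
extend {N} = insert (fromℕ N) (fromℕ N)

extend-inject₁ : (π : Permutation′ N) (k : Fin N) → extend π ⟨$⟩ʳ inject₁ k ≡ inject₁ (π ⟨$⟩ʳ k)
extend-inject₁ {N} π k = begin
  extend π ⟨$⟩ʳ inject₁ k            ≡⟨ cong (extend π ⟨$⟩ʳ_) (punchIn-fromℕ k) ⟨
  extend π ⟨$⟩ʳ punchIn (fromℕ N) k  ≡⟨ Perm.insert-punchIn (fromℕ N) (fromℕ N) π k ⟩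
  punchIn (fromℕ N) (π ⟨$⟩ʳ k)       ≡⟨ punchIn-fromℕ (π ⟨$⟩ʳ k) ⟩
  inject₁ (π ⟨$⟩ʳ k)                 ∎
  where open ≡-Reasoning

extend-fromℕ : (π : Permutation′ N) → extend π ⟨$⟩ʳ fromℕ N ≡ fromℕ N
extend-fromℕ {N} π with fromℕ N Fin.≟ fromℕ N
... | yes _ = refl
... | no ≢  = contradiction refl ≢

transpose-fixes : ∀ (i j : Fin N) {k} → k ≢ i → k ≢ j → transpose i j ⟨$⟩ʳ k ≡ k
transpose-fixes i j {k} k≢i k≢j rewrite dec-false (k Fin.≟ i) k≢i | dec-false (k Fin.≟ j) k≢j = refl

transpose-left : ∀ (i j : Fin N) → transpose i j ⟨$⟩ʳ i ≡ j
transpose-left i j rewrite dec-true (i Fin.≟ i) refl = refl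

transpose-right : ∀ (i j : Fin N) → transpose i j ⟨$⟩ʳ j ≡ i
transpose-right i j with j Fin.≟ i
... | yes j≡i = j≡i
... | no  _ rewrite dec-true (j Fin.≟ j) refl = refl

-- The inverse comes from `▹`; `flip (transpose j x)` acts by computation as `transpose x j`.
transpose-swaps : ∀ {n} (j x : Letter n) → Swaps {n} (flip (transpose j x)) x j
transpose-swaps j x = record
  { x↦y = transpose-left x j ; y↦x = transpose-right x j ; fixes = transpose-fixes x j }

transpose-natural : ∀ {M} (f : Fin M → Fin N) → (∀ {x y} → f x ≡ f y → x ≡ y) →
                    ∀ i j k → transpose (f i) (f j) ⟨$⟩ʳ f k ≡ f (transpose i j ⟨$⟩ʳ k)
transpose-natural f f-inj i j k = cases (k Fin.≟ i) (k Fin.≟ j)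
  where
  cases : Dec (k ≡ i) → Dec (k ≡ j) → transpose (f i) (f j) ⟨$⟩ʳ f k ≡ f (transpose i j ⟨$⟩ʳ k)
  cases (yes refl) _          = trans (transpose-left (f k) (f j)) (cong f (sym (transpose-left k j)))
  cases (no _)     (yes refl) = trans (transpose-right (f i) (f k)) (cong f (sym (transpose-right i k)))
  cases (no k≢i)   (no k≢j)   = trans (transpose-fixes (f i) (f j) (k≢i ∘ f-inj) (k≢j ∘ f-inj))
                                  (cong f (sym (transpose-fixes i j k≢i k≢j)))

module _ {n : ℕ} where

  lift : Permutation′ (n ℕ.* 2) → Permutation′ (suc n ℕ.* 2)
  lift σ = extend (extend σ)

  lift-inj : ∀ σ x → lift σ ⟨$⟩ʳ inj {n} x ≡ inj {n} (σ ⟨$⟩ʳ x)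
  lift-inj σ x = trans (extend-inject₁ (extend σ) (inject₁ x)) (cong inject₁ (extend-inject₁ σ x))

  lift-top : ∀ σ → lift σ ⟨$⟩ʳ top {n} ≡ top {n}
  lift-top σ = subst (λ t → lift σ ⟨$⟩ʳ t ≡ t) (sym (top≡ {n}))
    (trans (extend-inject₁ (extend σ) _) (cong inject₁ (extend-fromℕ σ)))

  lift-top̄ : ∀ σ → lift σ ⟨$⟩ʳ top̄ {n} ≡ top̄ {n}
  lift-top̄ σ = subst (λ t → lift σ ⟨$⟩ʳ t ≡ t) (sym (top̄≡ {n})) (extend-fromℕ (extend σ))

  bar-top̄ : bar {suc n} (top̄ {n}) ≡ top {n}
  bar-top̄ = bar-involutive {suc n} (top {n})

  lift-transpose : ∀ {i : Fin n} {j : Letter n} → j ∈ below i → ∀ σ →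
                   flip (transpose (inj {n} j) (plain (inject₁ i))) · lift σ ≈ lift (flip (transpose j (plain i)) · σ)
  lift-transpose {i} {j} j∈ σ y with oldOrNew {n} y
  ... | old x = begin
    transpose (plain (inject₁ i)) (inj {n} j) ⟨$⟩ʳ (lift σ ⟨$⟩ʳ inj {n} x)
      ≡⟨ cong₂ (λ z w → transpose z (inj {n} j) ⟨$⟩ʳ w) (sym (inj-combine i zero)) (lift-inj σ x) ⟩
    transpose (inj {n} (plain i)) (inj {n} j) ⟨$⟩ʳ inj {n} (σ ⟨$⟩ʳ x)
      ≡⟨ transpose-natural (inj {n}) (inj-injective {n}) (plain i) j (σ ⟨$⟩ʳ x) ⟩
    inj {n} (transpose (plain i) j ⟨$⟩ʳ (σ ⟨$⟩ʳ x))
      ≡⟨ lift-inj (flip (transpose j (plain i)) · σ) x ⟨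
    lift (flip (transpose j (plain i)) · σ) ⟨$⟩ʳ inj {n} x ∎
    where open ≡-Reasoning
  ... | new = trans (cong (transpose (plain (inject₁ i)) (inj {n} j) ⟨$⟩ʳ_) (lift-top σ))
    (trans (transpose-fixes (plain (inject₁ i)) (inj {n} j)
             (λ eq → proj₁ (<top⇒≢ {n} (inj<top {n} (plain i))) (trans (inj-combine i zero) (sym eq)))
             (λ eq → proj₁ (<top⇒≢ {n} (inj<top {n} j)) (sym eq)))
           (sym (lift-top _)))
  ... | new̄ = trans (cong (transpose (plain (inject₁ i)) (inj {n} j) ⟨$⟩ʳ_) (lift-top̄ σ))
    (trans (transpose-fixes (plain (inject₁ i)) (inj {n} j)
             (λ eq → proj₂ (<top⇒≢ {n} (inj<top {n} (plain i))) (trans (inj-combine i zero) (sym eq)))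
             (λ eq → proj₂ (<top⇒≢ {n} (inj<top {n} j)) (sym eq)))
           (sym (lift-top̄ _)))

  -- The new letters are fixed, so they form a cycle of length 2 in which the solid and the dashed
  -- edge coincide.
  lift-decomposition : ∀ {σ cs} → Decomposition {n} σ cs →
                       Decomposition {suc n} (lift σ) ((top {n} ∷ []) ∷ map (map (inj {n})) cs)
  lift-decomposition {σ} {cs} D = record
    { cyclic   = (top̄ {n} , sym (lift-top̄ σ) , trans (sym (lift-top σ)) (cong (lift σ ⟨$⟩ʳ_) (sym bar-top̄)))
                 ∷ All.map⁺ (All.map (λ {c} → cycle-inj c) (Decomposition.cyclic D))
    ; complete = begin
        top {n} ∷ top̄ {n} ∷ letters {suc n} (concat (map (map (inj {n})) cs))
          ≡⟨ cong (λ zs → top {n} ∷ top̄ {n} ∷ zs) (trans (cong (letters {suc n}) (List.concat-map cs)) (letters-map-inj (concat cs))) ⟩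
        top {n} ∷ top̄ {n} ∷ map (inj {n}) (letters {n} (concat cs))
          ↭⟨ prep _ (prep _ (↭.map⁺ (inj {n}) (Decomposition.complete D))) ⟩
        top {n} ∷ top̄ {n} ∷ map (inj {n}) (allFin (n ℕ.* 2))
          ↭⟨ allFin-suc {n} ⟨
        allFin (suc n ℕ.* 2) ∎
    }
    where
    open PermutationReasoning
    step-inj : ∀ {u v} → Step {n} σ u v → Step {suc n} (lift σ) (inj {n} u) (inj {n} v)
    step-inj {u} (z , eq₁ , eq₂) = inj {n} z ,
      trans (sym (inj-bar {n} u)) (trans (cong (inj {n}) eq₁) (sym (lift-inj σ z))) ,
      trans (cong (inj {n}) eq₂) (trans (sym (lift-inj σ _)) (cong (lift σ ⟨$⟩ʳ_) (inj-bar {n} z)))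
    chain-inj : ∀ {a} xs {b} → Chain (Step {n} σ) a xs b → Chain (Step {suc n} (lift σ)) (inj {n} a) (map (inj {n}) xs) (inj {n} b)
    chain-inj []       r        = step-inj r
    chain-inj (x ∷ xs) (r , rs) = step-inj r , chain-inj xs rs
    cycle-inj : ∀ c → Cycle {R = Step {n} σ} c → Cycle {R = Step {suc n} (lift σ)} (map (inj {n}) c)
    cycle-inj (x ∷ xs) = chain-inj xs

  hyperoctahedral-lift : ∀ σ → Hyperoctahedral (suc n) (lift σ) ⇔ Hyperoctahedral n σ
  hyperoctahedral-lift σ = mk⇔
    (λ h x → inj-injective {n} (begin
      inj {n} (bar {n} (σ ⟨$⟩ʳ x))            ≡⟨ inj-bar {n} _ ⟩
      bar {suc n} (inj {n} (σ ⟨$⟩ʳ x))        ≡⟨ cong (bar {suc n}) (lift-inj σ x) ⟨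
      bar {suc n} (lift σ ⟨$⟩ʳ inj {n} x)     ≡⟨ h (inj {n} x) ⟩
      lift σ ⟨$⟩ʳ bar {suc n} (inj {n} x)     ≡⟨ cong (lift σ ⟨$⟩ʳ_) (inj-bar {n} x) ⟨
      lift σ ⟨$⟩ʳ inj {n} (bar {n} x)         ≡⟨ lift-inj σ (bar {n} x) ⟩
      inj {n} (σ ⟨$⟩ʳ bar {n} x)              ∎))
    (λ h y → from h (oldOrNew {n} y))
    where
    open ≡-Reasoning
    from : Hyperoctahedral n σ → ∀ {y} → OldOrNew {n} y → bar {suc n} (lift σ ⟨$⟩ʳ y) ≡ lift σ ⟨$⟩ʳ bar {suc n} y
    from h (old x) = begin
      bar {suc n} (lift σ ⟨$⟩ʳ inj {n} x)     ≡⟨ cong (bar {suc n}) (lift-inj σ x) ⟩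
      bar {suc n} (inj {n} (σ ⟨$⟩ʳ x))        ≡⟨ inj-bar {n} _ ⟨
      inj {n} (bar {n} (σ ⟨$⟩ʳ x))            ≡⟨ cong (inj {n}) (h x) ⟩
      inj {n} (σ ⟨$⟩ʳ bar {n} x)              ≡⟨ lift-inj σ (bar {n} x) ⟨
      lift σ ⟨$⟩ʳ inj {n} (bar {n} x)         ≡⟨ cong (lift σ ⟨$⟩ʳ_) (inj-bar {n} x) ⟩
      lift σ ⟨$⟩ʳ bar {suc n} (inj {n} x)     ∎
    from h new = trans (cong (bar {suc n}) (lift-top σ)) (sym (lift-top̄ σ))
    from h new̄ = trans (cong (bar {suc n}) (lift-top̄ σ))
      (trans bar-top̄ (trans (sym (lift-top σ)) (cong (lift σ ⟨$⟩ʳ_) (sym bar-top̄))))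

-- Products of Jucys–Murphy elements

-- A product of factors applied one convolution at a time, the leftmost acting first on the
-- argument, so that inductions meet a single transposition per step.
word : (x : A → ℤ[S N ]) → List A → (Permutation′ N → ℤ) → Permutation′ N → ℤ
word x is g = foldr (λ i → x i ▹_) g is

word-invariant : (x : A → ℤ[S N ]) (is : List A) {g : Permutation′ N → ℤ} → Invariant g → Invariant (word x is g)
word-invariant x []       inv = inv
word-invariant x (i ∷ is) inv = ▹-invariant (x i) (word-invariant x is inv)

word-▹ : (x : A → ℤ[S N ]) (is : List A) {g : Permutation′ N → ℤ} → Invariant g →
         ∀ σ → (foldr _⊛_ 𝟙 (map x is) ▹ g) σ ≡ word x is g σ
word-▹ x []       {g} inv σ = trans (ℤ.+-identityʳ _) (trans (ℤ.*-identityˡ _)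
  (inv (flip Perm.id · σ) σ λ _ → refl))
word-▹ x (i ∷ is) inv σ = trans (▹-⊛ (x i) _ inv σ) (▹-cong (x i) (word-▹ x is inv) σ)

module _ {n : ℕ} where

  JM-▹ : ∀ (i : Fin n) g σ → (JM n i ▹ g) σ ≡ Σ[ below i ] (λ j → g (flip (transpose j (plain i)) · σ))
  JM-▹ i g σ = begin
    Σ[ sumOf (map τ (below i)) ] (λ s → proj₁ s * g (flip (proj₂ s) · σ))
      ≡⟨ Σ-map (1ℤ ,_) (map τ (below i)) (λ s → proj₁ s * g (flip (proj₂ s) · σ)) ⟩
    Σ[ map τ (below i) ] (λ π → 1ℤ * g (flip π · σ))
      ≡⟨ Σ-map τ (below i) (λ π → 1ℤ * g (flip π · σ)) ⟩
    Σ[ below i ] (λ j → 1ℤ * g (flip (τ j) · σ))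
      ≡⟨ Σ-cong (below i) (λ _ → ℤ.*-identityˡ _) ⟩
    Σ[ below i ] (λ j → g (flip (τ j) · σ)) ∎
    where
    open ≡-Reasoning
    τ : Letter n → Permutation′ (n ℕ.* 2)
    τ j = transpose j (plain i)

  hyperoctahedral-≈ : ∀ {σ τ} → τ ≈ σ → Hyperoctahedral n τ ⇔ Hyperoctahedral n σ
  hyperoctahedral-≈ {σ} {τ} τ≈σ = mk⇔
    (λ h x → trans (cong (bar {n}) (sym (τ≈σ x))) (trans (h x) (τ≈σ (bar {n} x))))
    (λ h x → trans (cong (bar {n}) (τ≈σ x)) (trans (h x) (sym (τ≈σ (bar {n} x)))))

  coeff-p : ∀ σ → coeff (p n) σ ≡ 𝟏 (hyperoctahedral? n σ)
  coeff-p σ = coeff-filter (hyperoctahedral? n) (hyperoctahedral? n σ) σ (λ {τ} → hyperoctahedral-≈ {σ} {τ})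

  coefficient : ℕ → Permutation′ (n ℕ.* 2) → ℤ
  coefficient k = coeff (completeHomogeneous k (JM n) ⊛ p n)

  coefficient-words : ∀ k σ → coefficient k σ ≡ Σ[ monomials k n ] (λ is → word (JM n) is (coeff (p n)) σ)
  coefficient-words k σ = begin
    coeff (completeHomogeneous k (JM n) ⊛ p n) σ
      ≡⟨ coeff-⊛ (completeHomogeneous k (JM n)) (p n) σ ⟩
    (completeHomogeneous k (JM n) ▹ coeff (p n)) σ
      ≡⟨ ▹-concatMap (λ is → foldr _⊛_ 𝟙 (map (JM n) is)) (monomials k n) (coeff (p n)) σ ⟩
    Σ[ monomials k n ] (λ is → (foldr _⊛_ 𝟙 (map (JM n) is) ▹ coeff (p n)) σ)
      ≡⟨ Σ-cong (monomials k n) (λ {is} _ → word-▹ (JM n) is (coeff-invariant (p n)) σ) ⟩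
    Σ[ monomials k n ] (λ is → word (JM n) is (coeff (p n)) σ) ∎
    where open ≡-Reasoning

module _ {n : ℕ} where

  -- A monomial of positive degree either begins with the largest index or avoids it, as in the
  -- recursion of `monomials`. In the first case the remaining words are summed to a coefficient
  -- again, for each j separately.
  coefficient-recursion : ∀ k σ → coefficient {suc n} (suc k) σ ≡
    Σ[ below (fromℕ n) ] (λ j → coefficient {suc n} k (flip (transpose j (top {n})) · σ)) +
    Σ[ monomials (suc k) n ] (λ is → word (JM (suc n)) (map inject₁ is) (coeff (p (suc n))) σ)
  coefficient-recursion k σ = begin
    coefficient {suc n} (suc k) σ
      ≡⟨ coefficient-words {suc n} (suc k) σ ⟩
    Σ[ map (fromℕ n ∷_) (monomials k (suc n)) ++ map (map inject₁) (monomials (suc k) n) ] W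
      ≡⟨ Σ-++ (map (fromℕ n ∷_) (monomials k (suc n))) _ W ⟩
    Σ[ map (fromℕ n ∷_) (monomials k (suc n)) ] W + Σ[ map (map inject₁) (monomials (suc k) n) ] W
      ≡⟨ cong₂ _+_ (Σ-map (fromℕ n ∷_) (monomials k (suc n)) W) (Σ-map (map inject₁) (monomials (suc k) n) W) ⟩
    Σ[ monomials k (suc n) ] (λ is → W (fromℕ n ∷ is)) + rest
      ≡⟨ cong (λ z → z + rest) (begin
           Σ[ monomials k (suc n) ] (λ is → W (fromℕ n ∷ is))
             ≡⟨ Σ-cong (monomials k (suc n)) (λ {is} _ → JM-▹ (fromℕ n) (W′ is) σ) ⟩
           Σ[ monomials k (suc n) ] (λ is → Σ[ below (fromℕ n) ] (λ j → W′ is (σ′ j)))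
             ≡⟨ Σ-swap (monomials k (suc n)) (below (fromℕ n)) (λ is j → W′ is (σ′ j)) ⟩
           Σ[ below (fromℕ n) ] (λ j → Σ[ monomials k (suc n) ] (λ is → W′ is (σ′ j)))
             ≡⟨ Σ-cong (below (fromℕ n)) (λ {j} _ → sym (coefficient-words {suc n} k (σ′ j))) ⟩
           Σ[ below (fromℕ n) ] (λ j → coefficient {suc n} k (σ′ j)) ∎) ⟩
    Σ[ below (fromℕ n) ] (λ j → coefficient {suc n} k (σ′ j)) + rest ∎
    where
    open ≡-Reasoning
    σ′ : Letter (suc n) → Permutation′ (suc n ℕ.* 2)
    σ′ j = flip (transpose j (top {n})) · σ
    W′ : List (Fin (suc n)) → Permutation′ (suc n ℕ.* 2) → ℤ
    W′ is = word (JM (suc n)) is (coeff (p (suc n)))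
    W : List (Fin (suc n)) → ℤ
    W is = W′ is σ
    rest = Σ[ monomials (suc k) n ] (W ∘ map inject₁)

  -- The transpositions in the word involve old letters only and so commute with `lift`; at the
  -- empty word, lifting preserves being hyperoctahedral in both directions.
  word-lift : ∀ is σ → word (JM (suc n)) (map inject₁ is) (coeff (p (suc n))) (lift {n} σ) ≡ word (JM n) is (coeff (p n)) σ
  word-lift []       σ = begin
    coeff (p (suc n)) (lift {n} σ)                  ≡⟨ coeff-p {suc n} (lift {n} σ) ⟩
    𝟏 (hyperoctahedral? (suc n) (lift {n} σ))       ≡⟨ cong (if_then 1ℤ else 0ℤ)
      (does-⇔ (hyperoctahedral-lift {n} σ) (hyperoctahedral? (suc n) (lift {n} σ)) (hyperoctahedral? n σ)) ⟩
    𝟏 (hyperoctahedral? n σ)                        ≡⟨ coeff-p {n} σ ⟨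
    coeff (p n) σ                                   ∎
    where open ≡-Reasoning
  word-lift (i ∷ is) σ = begin
    (JM (suc n) (inject₁ i) ▹ W) (lift {n} σ)
      ≡⟨ JM-▹ (inject₁ i) W (lift {n} σ) ⟩
    Σ[ below (inject₁ i) ] (λ j → W (flip (transpose j (plain (inject₁ i))) · lift {n} σ))
      ≡⟨ Σ-↭ _ (below-inject₁ i) ⟩
    Σ[ map (inj {n}) (below i) ] (λ j → W (flip (transpose j (plain (inject₁ i))) · lift {n} σ))
      ≡⟨ Σ-map (inj {n}) (below i) (λ j → W (flip (transpose j (plain (inject₁ i))) · lift {n} σ)) ⟩
    Σ[ below i ] (λ j → W (flip (transpose (inj {n} j) (plain (inject₁ i))) · lift {n} σ))
      ≡⟨ Σ-cong (below i) (λ {j} j∈ → trans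
           (word-invariant (JM (suc n)) (map inject₁ is) (coeff-invariant (p (suc n)))
             (flip (transpose (inj {n} j) (plain (inject₁ i))) · lift {n} σ)
             (lift {n} (flip (transpose j (plain i)) · σ)) (lift-transpose {n} j∈ σ))
           (word-lift is (flip (transpose j (plain i)) · σ))) ⟩
    Σ[ below i ] (λ j → word (JM n) is (coeff (p n)) (flip (transpose j (plain i)) · σ))
      ≡⟨ JM-▹ i (word (JM n) is (coeff (p n))) σ ⟨
    (JM n i ▹ word (JM n) is (coeff (p n))) σ ∎
    where
    open ≡-Reasoning
    W = word (JM (suc n)) (map inject₁ is) (coeff (p (suc n)))

  -- The transpositions in the word fix `top` and `top̄`, so the absence of a dashed edge between
  -- them persists down to the empty word, where it contradicts being hyperoctahedral.
  word-vanishes : ∀ is σ → ¬ Dashed (suc n) σ (top {n}) (top̄ {n}) →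
                  word (JM (suc n)) (map inject₁ is) (coeff (p (suc n))) σ ≡ 0ℤ
  word-vanishes []       σ ¬d = trans (coeff-p {suc n} σ) (cong (if_then 1ℤ else 0ℤ)
    -- If σ commutes with `bar`, the preimage of `top` and its bar are sent to `top` and `top̄`.
    (dec-false (hyperoctahedral? (suc n) σ) λ h → ¬d (σ ⟨$⟩ˡ top {n} , sym (Perm.inverseʳ σ) ,
      trans (cong (bar {suc n}) (sym (Perm.inverseʳ σ))) (h (σ ⟨$⟩ˡ top {n})))))
  word-vanishes (i ∷ is) σ ¬d = trans (JM-▹ (inject₁ i) W σ)
    (Σ-zero (below (inject₁ i)) λ {j} j∈ → word-vanishes is (flip (transpose j (plain (inject₁ i))) · σ) (¬d′ j∈))
    where
    W = word (JM (suc n)) (map inject₁ is) (coeff (p (suc n)))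
    plain-inject₁≢ : plain (inject₁ i) ≢ top {n} × plain (inject₁ i) ≢ top̄ {n}
    plain-inject₁≢ = <top⇒≢ {n} (subst (Fin._< top {n}) (inj-combine i zero) (inj<top {n} (plain i)))
    ¬d′ : ∀ {j} → j ∈ below (inject₁ i) →
          ¬ Dashed (suc n) (flip (transpose j (plain (inject₁ i))) · σ) (top {n}) (top̄ {n})
    ¬d′ {j} j∈ (z , eq₁ , eq₂) = ¬d (z ,
      τ-injective (trans (τ-fixes (proj₁ plain-inject₁≢) (proj₁ (below-inject₁≢ {n} {i} j∈))) eq₁) ,
      τ-injective (trans (τ-fixes (proj₂ plain-inject₁≢) (proj₂ (below-inject₁≢ {n} {i} j∈))) eq₂))
      where
      τ = flip (transpose j (plain (inject₁ i)))
      τ-fixes : ∀ {y} → plain (inject₁ i) ≢ y → j ≢ y → τ ⟨$⟩ʳ y ≡ y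
      τ-fixes i≢ j≢ = transpose-fixes (plain (inject₁ i)) j (i≢ ∘ sym) (j≢ ∘ sym)
      τ-injective : ∀ {y z} → τ ⟨$⟩ʳ y ≡ τ ⟨$⟩ʳ z → y ≡ z
      τ-injective eq = trans (sym (Perm.inverseˡ τ)) (trans (cong (τ ⟨$⟩ˡ_) eq) (Perm.inverseˡ τ))

-- Permutations of a given coset-type

erase-↭ : ∀ {r xs} → r ∈ xs → xs ↭ r ∷ erase r xs
erase-↭ {r} {x ∷ xs} r∈ with r ℕ.≟ x
erase-↭ r∈          | yes refl = ↭-refl
erase-↭ (here refl) | no r≢x   = contradiction refl r≢x
erase-↭ (there r∈)  | no r≢x   = ↭-trans (prep _ (erase-↭ r∈)) (swap _ _ ↭-refl)

fromParts-↭ : ∀ {xs} (ps : All NonZero xs) → xs ↭ parts (fromParts xs ps)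
fromParts-↭ {xs} ps = ↭-sym (sort≥-↭ xs)

HasPermutation : List ℕ → Set
HasPermutation rs = ∃ λ n → ∃₂ λ σ cs → Decomposition {n} σ cs × map length cs ≡ rs

-- The cycle of `top` has one solid edge more than `m`, since its head is not counted in `xs`.
HasPermutation′ : ℕ → List ℕ → Set
HasPermutation′ m rs = ∃ λ n → ∃ λ σ → ∃₂ λ xs cs →
  Decomposition {suc n} σ ((top {n} ∷ xs) ∷ cs) × length xs ≡ m × map length cs ≡ rs

map-length-inj : ∀ {n} (cs : List (List (Letter n))) → map length (map (map (inj {n})) cs) ≡ map length cs
map-length-inj {n} cs = trans (sym (List.map-∘ cs)) (List.map-cong (List.length-map (inj {n})) cs)

-- The cycle of the last letter grows by one solid edge at a time: a new index is adjoined as a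
-- cycle of length 2 and joined to the cycle of the previous `top`.
hasPermutation′ : ∀ m {rs} → HasPermutation rs → HasPermutation′ m rs
hasPermutation′ zero    (n , σ , cs , D , len) =
  n , lift {n} σ , [] , map (map (inj {n})) cs , lift-decomposition {n} D , refl , trans (map-length-inj {n} cs) len
hasPermutation′ (suc m) h with hasPermutation′ m h
... | n , σ , xs , cs , D , refl , len =
  suc n , flip (transpose y x) · lift {suc n} σ , y ∷ map (inj {suc n}) xs , map (map (inj {suc n})) cs ,
  join [] (map (inj {suc n}) xs) (transpose-swaps {suc (suc n)} y x) (lift-decomposition {suc n} D) ,
  cong suc (List.length-map (inj {suc n}) xs) , trans (map-length-inj {suc n} cs) len
  where
  x = top {suc n}
  y = inj {suc n} (top {n})

hasPermutation : ∀ rs → All NonZero rs → HasPermutation rs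
hasPermutation []           []       = zero , Perm.id , [] , record { cyclic = [] ; complete = ↭-refl } , refl
hasPermutation (zero ∷ rs)  (() ∷ _)
hasPermutation (suc m ∷ rs) (_ ∷ ps) with hasPermutation′ m (hasPermutation rs ps)
... | n , σ , xs , cs , D , refl , len = suc n , σ , (top {n} ∷ xs) ∷ cs , D , cong (suc (length xs) ∷_) len

-- Sums over the letters of cycles

Σ-letters : ∀ {n} (xs : List (Letter n)) (f : Letter n → ℤ) →
            Σ[ letters {n} xs ] f ≡ Σ[ xs ] f + Σ[ xs ] (f ∘ bar {n})
Σ-letters []           f = refl
Σ-letters {n} (x ∷ xs) f = begin
  f x + (f (bar {n} x) + Σ[ letters {n} xs ] f)
    ≡⟨ ℤ.+-assoc (f x) (f (bar {n} x)) _ ⟨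
  (f x + f (bar {n} x)) + Σ[ letters {n} xs ] f
    ≡⟨ cong (_+_ (f x + f (bar {n} x))) (Σ-letters {n} xs f) ⟩
  (f x + f (bar {n} x)) + (Σ[ xs ] f + Σ[ xs ] (f ∘ bar {n}))
    ≡⟨ interchange (f x) (f (bar {n} x)) _ _ ⟩
  (f x + Σ[ xs ] f) + (f (bar {n} x) + Σ[ xs ] (f ∘ bar {n})) ∎
  where open ≡-Reasoning

Σ-letters-concat : ∀ {n} (cs : List (List (Letter n))) (f : Letter n → ℤ) (h : ℕ → ℤ) →
                   (∀ {c j} → c ∈ cs → j ∈ letters {n} c → f j ≡ h (length c)) →
                   Σ[ letters {n} (concat cs) ] f ≡ + 2 * Σ[ map length cs ] (λ r → + r * h r)
Σ-letters-concat []           f h f≡ = refl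
Σ-letters-concat {n} (c ∷ cs) f h f≡ = begin
  Σ[ letters {n} (c ++ concat cs) ] f
    ≡⟨ cong (λ zs → Σ[ zs ] f) (letters-++ {n} c (concat cs)) ⟩
  Σ[ letters {n} c ++ letters {n} (concat cs) ] f
    ≡⟨ Σ-++ (letters {n} c) _ f ⟩
  Σ[ letters {n} c ] f + Σ[ letters {n} (concat cs) ] f
    ≡⟨ cong₂ _+_ (begin
         Σ[ letters {n} c ] f                        ≡⟨ Σ-cong (letters {n} c) (f≡ (here refl)) ⟩
         Σ[ letters {n} c ] (λ _ → h r)              ≡⟨ Σ-const (letters {n} c) (h r) ⟩
         + length (letters {n} c) * h r              ≡⟨ cong (λ l → + l * h r) (length-letters {n} c) ⟩
         + (2 ℕ.* r) * h r                           ≡⟨ cong (_* h r) (ℤ.pos-* 2 r) ⟩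
         + 2 * + r * h r                             ≡⟨ ℤ.*-assoc (+ 2) (+ r) (h r) ⟩
         + 2 * (+ r * h r)                           ∎)
       (Σ-letters-concat {n} cs f h (f≡ ∘ there)) ⟩
  + 2 * (+ r * h r) + + 2 * Σ[ map length cs ] (λ r → + r * h r)
    ≡⟨ ℤ.*-distribˡ-+ (+ 2) (+ r * h r) _ ⟨
  + 2 * Σ[ map length (c ∷ cs) ] (λ r → + r * h r) ∎
  where
  open ≡-Reasoning
  r = length c

-- `opposite i` counts the entries after position i. With r = `suc (length as)` and s =
-- `suc (length bs)`, every ordered pair with r + s = `suc (length xs)` arises from one i.
split-at : (xs : List A) (i : Fin (length xs)) →
           ∃₂ λ as bs → xs ≡ as ++ lookup xs i ∷ bs × length as ≡ toℕ i × length bs ≡ toℕ (opposite i)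
split-at (x ∷ xs) zero    = [] , xs , refl , refl , sym (Fin.toℕ-fromℕ (length xs))
split-at (x ∷ xs) (suc i) with split-at xs i
... | as , bs , eq , |as| , |bs| = x ∷ as , bs , cong (x ∷_) eq , cong suc |as| ,
                                   trans |bs| (sym (Fin.toℕ-inject₁ (opposite i)))

Σ-splittings : (xs : List A) (f : A → ℤ) (h : ℕ → ℕ → ℤ) →
               (∀ as y bs → xs ≡ as ++ y ∷ bs → f y ≡ h (length as) (length bs)) →
               Σ[ xs ] f ≡ ∑[ t < length xs ] h (toℕ t) (toℕ (opposite t))
Σ-splittings xs f h f≡ = trans (sym (∑-lookup xs f)) (sum-cong-≗ λ i →
  let as , bs , eq , |as| , |bs| = split-at xs i in
  trans (f≡ as (lookup xs i) bs eq) (cong₂ h |as| |bs|))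

-- The only dashed neighbour of `top̄` is the next recorded letter y, which differs from `top`.
top-not-dashed : ∀ {n σ y ys cs} → Decomposition {suc n} σ ((top {n} ∷ y ∷ ys) ∷ cs) →
                 ¬ Dashed (suc n) σ (top {n}) (top̄ {n})
top-not-dashed {n} {σ} D d with Decomposition.cyclic D | decomposition-unique {suc n} D
... | (s , _) ∷ _ | (_ ∷ x≢y ∷ _) ∷ _ =
  x≢y (dashed-functional {suc n} {σ} (dashed-sym {suc n} {σ} d) s)

-- The recurrence, evaluated at a permutation of the required type

module _ (b : ℕ → Partition → ℤ) (isC : IsCoefficients b) where

  -- The defining equation of `b` enters here: at a permutation with known cycles, the coefficient
  -- is a single value of `b`.
  coefficient-type : ∀ {n σ cs} → Decomposition {n} σ cs → ∀ k {μ} → map length cs ↭ parts μ →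
                     coefficient {n} k σ ≡ b k μ
  coefficient-type {n} {σ} D k {μ} p = trans (isC k n σ) (coeff-decomposition {n} D (b k) {μ} p)

  module _ (ρ : Partition) (k : ℕ) {n : ℕ} {σ : Permutation′ (suc n ℕ.* 2)}
           {xs : List (Letter (suc n))} {cs : List (List (Letter (suc n)))}
           (D : Decomposition {suc n} σ ((top {n} ∷ xs) ∷ cs)) (len : map length cs ≡ parts ρ) where

    private
      -- The cycle of `top` has `suc m` solid edges, so this is the factor m - 1 of the English
      -- statement.
      m = length xs

      τ : Letter (suc n) → Permutation′ (suc n ℕ.* 2)
      τ j = flip (transpose j (top {n}))

      f : Letter (suc n) → ℤ
      f j = coefficient {suc n} k (τ j · σ)

    ∪-↭ : ∀ {r} → r ≡ suc m → r ∷ map length cs ↭ parts (ρ ∪ suc m)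
    ∪-↭ refl = ↭-trans (prep _ (↭-reflexive len)) (fromParts-↭ (_ ∷ positive ρ))

    -- For an unbarred letter y of the cycle oriented from `top`, the transposition cuts just before
    -- y: `as` stays with `top`, and `bs` with y.
    cut-term : ∀ as y bs → xs ≡ as ++ y ∷ bs → f y ≡ b k (ρ ∪ suc (length as) ∪ suc (length bs))
    cut-term as y bs refl = coefficient-type
      (cut as bs (transpose-swaps {suc n} y (top {n})) D) k {ρ ∪ suc (length as) ∪ suc (length bs)} (begin
        suc (length as) ∷ suc (length bs) ∷ map length cs   ↭⟨ swap _ _ (↭-reflexive len) ⟩
        suc (length bs) ∷ suc (length as) ∷ parts ρ         ↭⟨ prep _ (fromParts-↭ (_ ∷ positive ρ)) ⟩
        suc (length bs) ∷ parts (ρ ∪ suc (length as))       ↭⟨ fromParts-↭ (_ ∷ positive (ρ ∪ suc (length as))) ⟩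
        parts (ρ ∪ suc (length as) ∪ suc (length bs))       ∎)
      where open PermutationReasoning

    -- For the barred letters the cycle is only partly reversed and keeps its length; there are as
    -- many of them as entries of `xs`.
    twist-term : ∀ {y} → y ∈ xs → f (bar {suc n} y) ≡ b k (ρ ∪ suc m)
    twist-term {y} y∈ with ∈-∃++ y∈
    ... | as , bs , refl = coefficient-type
      (twist as bs (transpose-swaps {suc n} (bar {suc n} y) (top {n})) D) k {ρ ∪ suc m}
      (∪-↭ (cong suc (begin
        length (as ++ y ∷ reverse (map (bar {suc n}) bs))
          ≡⟨ List.length-++ as ⟩
        length as ℕ.+ suc (length (reverse (map (bar {suc n}) bs)))
          ≡⟨ cong (λ l → length as ℕ.+ suc l) (trans (List.length-reverse (map (bar {suc n}) bs)) (List.length-map (bar {suc n}) bs)) ⟩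
        length as ℕ.+ length (y ∷ bs)
          ≡⟨ List.length-++ as ⟨
        length (as ++ y ∷ bs) ∎)))
      where open ≡-Reasoning

    -- The value depends on j only through the length of its cycle, so all 2r letters of a cycle
    -- with r solid edges contribute equally.
    join-term : ∀ {c j} → c ∈ cs → j ∈ letters {suc n} c → f j ≡ b k (ρ ∖ length c ∪ (suc m ℕ.+ length c))
    join-term {c} {j} c∈ j∈ with expose {suc n} D c∈ j∈
    ... | c′ , cs′ , D′ , |c′| , p = coefficient-type
      (join xs c′ (transpose-swaps {suc n} j (top {n})) D′) k {ρ ∖ r ∪ (suc m ℕ.+ r)} (begin
        suc (length (xs ++ j ∷ c′)) ∷ map length cs′
          ≡⟨ cong (λ l → suc l ∷ map length cs′) (trans (List.length-++ xs) (cong (m ℕ.+_) |c′|)) ⟩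
        (suc m ℕ.+ r) ∷ map length cs′
          ↭⟨ prep _ (drop-∷ erased) ⟩
        (suc m ℕ.+ r) ∷ erase r (parts ρ)
          ↭⟨ prep _ (fromParts-↭ (erase⁺ r (positive ρ))) ⟩
        (suc m ℕ.+ r) ∷ parts (ρ ∖ r)
          ↭⟨ fromParts-↭ (_ ∷ positive (ρ ∖ r)) ⟩
        parts (ρ ∖ r ∪ (suc m ℕ.+ r)) ∎)
      where
      open PermutationReasoning
      r = length c
      lengths : parts ρ ↭ r ∷ map length cs′
      lengths = ↭-trans (↭-reflexive (sym len)) (↭.map⁺ length p)
      erased : r ∷ map length cs′ ↭ r ∷ erase r (parts ρ)
      -- `erase` may remove a different occurrence of r than the one belonging to this cycle; as
      -- multisets the remainders agree.
      erased = ↭-trans (↭-sym lengths) (erase-↭ (∈-resp-↭ (↭-sym lengths) (here refl)))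

    cycle-terms : Σ[ below (fromℕ n) ] f ≡
      + 2 * ∑[ i < ℓ ρ ] (+ part ρ i * b k (ρ ∖ part ρ i ∪ (suc m ℕ.+ part ρ i)))
      + ∑[ t < m ] (b k (ρ ∪ suc (toℕ t) ∪ suc (toℕ (opposite t))))
      + + m * b k (ρ ∪ suc m)
    cycle-terms = begin
      Σ[ below (fromℕ n) ] f
        ≡⟨ Σ-↭ f (below-top-letters {n} D) ⟩
      Σ[ letters {suc n} (xs ++ concat cs) ] f
        ≡⟨ cong (λ zs → Σ[ zs ] f) (letters-++ {suc n} xs (concat cs)) ⟩
      Σ[ letters {suc n} xs ++ letters {suc n} (concat cs) ] f
        ≡⟨ Σ-++ (letters {suc n} xs) _ f ⟩
      Σ[ letters {suc n} xs ] f + Σ[ letters {suc n} (concat cs) ] f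
        ≡⟨ ℤ.+-comm (Σ[ letters {suc n} xs ] f) _ ⟩
      Σ[ letters {suc n} (concat cs) ] f + Σ[ letters {suc n} xs ] f
        ≡⟨ cong₂ _+_ joins (Σ-letters {suc n} xs f) ⟩
      + 2 * J + (Σ[ xs ] f + Σ[ xs ] (f ∘ bar {suc n}))
        ≡⟨ cong₂ (λ y z → + 2 * J + (y + z)) (Σ-splittings xs f h cut-term)
             (trans (Σ-cong xs twist-term) (Σ-const xs (b k (ρ ∪ suc m)))) ⟩
      + 2 * J + (T + + m * b k (ρ ∪ suc m))
        ≡⟨ ℤ.+-assoc (+ 2 * J) T _ ⟨
      + 2 * J + T + + m * b k (ρ ∪ suc m) ∎
      where
      open ≡-Reasoning
      g : ℕ → ℤ
      g r = b k (ρ ∖ r ∪ (suc m ℕ.+ r))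
      h : ℕ → ℕ → ℤ
      h r s = b k (ρ ∪ suc r ∪ suc s)
      J = ∑[ i < ℓ ρ ] (+ part ρ i * g (part ρ i))
      T = ∑[ t < m ] h (toℕ t) (toℕ (opposite t))
      joins : Σ[ letters {suc n} (concat cs) ] f ≡ + 2 * J
      joins = trans (Σ-letters-concat {suc n} cs f g join-term)
        (cong (_*_ (+ 2)) (trans (cong (λ rs → Σ[ rs ] (λ r → + r * g r)) len)
          (sym (∑-lookup (parts ρ) (λ r → + r * g r)))))

    -- `c` is the contribution of the words avoiding the last index. It is left open because it is
    -- the only part that depends on whether `top` and `top̄` share a dashed edge.
    recurrence : ∀ c → Σ[ monomials (suc k) n ] (λ is → word (JM (suc n)) (map inject₁ is) (coeff (p (suc n))) σ) ≡ c →
      b (suc k) (ρ ∪ suc m) ≡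
      c
      + + 2 * ∑[ i < ℓ ρ ] (+ part ρ i * b k (ρ ∖ part ρ i ∪ (suc m ℕ.+ part ρ i)))
      + ∑[ t < m ] (b k (ρ ∪ suc (toℕ t) ∪ suc (toℕ (opposite t))))
      + + m * b k (ρ ∪ suc m)
    recurrence c rest = begin
      b (suc k) (ρ ∪ suc m)
        ≡⟨ coefficient-type D (suc k) {ρ ∪ suc m} (∪-↭ refl) ⟨
      coefficient {suc n} (suc k) σ
        ≡⟨ coefficient-recursion {n} k σ ⟩
      Σ[ below (fromℕ n) ] f + Σ[ monomials (suc k) n ] W
        ≡⟨ cong₂ _+_ cycle-terms rest ⟩
      X + Y + Z + c
        ≡⟨ ℤ.+-comm (X + Y + Z) c ⟩
      c + (X + Y + Z)
        ≡⟨ ℤ.+-assoc c (X + Y) Z ⟨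
      c + (X + Y) + Z
        ≡⟨ cong (λ w → w + Z) (ℤ.+-assoc c X Y) ⟨
      c + X + Y + Z ∎
      where
      open ≡-Reasoning
      W : List (Fin n) → ℤ
      W is = word (JM (suc n)) (map inject₁ is) (coeff (p (suc n))) σ
      X = + 2 * ∑[ i < ℓ ρ ] (+ part ρ i * b k (ρ ∖ part ρ i ∪ (suc m ℕ.+ part ρ i)))
      Y = ∑[ t < m ] (b k (ρ ∪ suc (toℕ t) ∪ suc (toℕ (opposite t))))
      Z = + m * b k (ρ ∪ suc m)

theorem3p5 : (b : ℕ → Partition → ℤ) → IsCoefficients b →
    (ρ : Partition) (k m : ℕ) →
    b (suc k) (ρ ∪ suc m) ≡
    δ (suc m) 1 * b (suc k) ρ
    + + 2 * ∑[ i < ℓ ρ ] (+ part ρ i * b k (ρ ∖ part ρ i ∪ (suc m ℕ.+ part ρ i)))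
    + ∑[ t < m ] (b k (ρ ∪ suc (toℕ t) ∪ suc (toℕ (opposite t))))
    + + m * b k (ρ ∪ suc m)
theorem3p5 b isC ρ k zero with hasPermutation (parts ρ) (positive ρ)
... | n , σ , cs , D , len = recurrence b isC ρ k (lift-decomposition {n} D) (trans (map-length-inj {n} cs) len)
  -- The evaluation point is a lifted permutation, so the words avoiding the last index add up to
  -- the coefficient at σ itself, whose type is ρ.
  (1ℤ * b (suc k) ρ) (begin
    Σ[ monomials (suc k) n ] (λ is → word (JM (suc n)) (map inject₁ is) (coeff (p (suc n))) (lift {n} σ))
      ≡⟨ Σ-cong (monomials (suc k) n) (λ {is} _ → word-lift {n} is σ) ⟩
    Σ[ monomials (suc k) n ] (λ is → word (JM n) is (coeff (p n)) σ)
      ≡⟨ coefficient-words {n} (suc k) σ ⟨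
    coefficient {n} (suc k) σ
      ≡⟨ coefficient-type b isC D (suc k) {ρ} (↭-reflexive len) ⟩
    b (suc k) ρ
      ≡⟨ ℤ.*-identityˡ (b (suc k) ρ) ⟨
    1ℤ * b (suc k) ρ ∎)
  where open ≡-Reasoning
theorem3p5 b isC ρ k (suc m) with hasPermutation′ (suc m) (hasPermutation (parts ρ) (positive ρ))
... | n , σ , y ∷ ys , cs , D , refl , len = recurrence b isC ρ k D len
  -- The cycle of `top` has a second solid edge, so each of these words contributes 0.
  (0ℤ * b (suc k) ρ) (trans
    (Σ-zero (monomials (suc k) n) λ {is} _ → word-vanishes {n} is σ (top-not-dashed {n} {σ} D))
    (sym (ℤ.*-zeroˡ (b (suc k) ρ))))
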